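{- $R(4)=7$, where for a positive integer $\omega$, $R(\omega)$ denotes the maximum number of colors that Builder can force Algorithm to use in the on-line proper interval coloring game with clique bound $\omega$.
   Context: The on-line proper interval coloring game with clique bound $\omega$ (a positive integer) is a two-player game between Builder and Algorithm, played in rounds. In each round, Builder presents a closed interval on the real line that is neither contained in nor contains any previously presented interval. Algorithm then immediately and irrevocably assigns the interval a color that has not been assigned to any previously presented interval intersecting it. The presented intervals form an interval representation of a unit interval graph (vertices are the intervals; two are adjacent if and only if the intervals intersect) and the colors form a proper coloring of that graph. Builder is restricted so that the graph constructed never contains a clique of size $\omega+1$ (equivalently, no real number lies in more than $\omega$ of the presented intervals). Builder may adapt to the colors chosen by Algorithm, and the game is finite. $R(\omega)$ is the maximum integer $m$ such that Builder has a strategy that forces Algorithm, however it plays, to use (at least) $m$ distinct colors. -}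

module Defs where

open import Data.List using (List; []; _∷_; map; length; deduplicate)
open import Data.List.Membership.Propositional using (_∈_)
open import Data.List.Relation.Binary.Sublist.Propositional using () renaming (_⊆_ to _⊑_)
open import Data.List.Relation.Unary.All using (All)
open import Data.List.Relation.Unary.AllPairs using (AllPairs)
open import Data.Nat using (ℕ; suc; _≤_; _≟_)
open import Data.Product using (Σ; ∃; _×_; _,_; proj₁; proj₂)
open import Data.Rational using (ℚ) renaming (_<_ to _<ℚ_)
open import Data.Sum using (_⊎_)
open import Function.Bundles using (_⇔_)
open import Relation.Binary.PropositionalEquality using (_≡_; _≢_)
open import Relation.Nullary using (¬_)

-- Real numbers as two-sided Dedekind cuts of ℚ.  Equality of reals is mutual
-- _≤ᴿ_, not _≡_.
record ℝ : Set₁ where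
  field
    Lower Upper : ℚ → Set
    lower-inhabited : ∃ Lower
    upper-inhabited : ∃ Upper
    lower-rounded   : ∀ q → Lower q ⇔ (∃ λ r → q <ℚ r × Lower r)
    upper-rounded   : ∀ r → Upper r ⇔ (∃ λ q → q <ℚ r × Upper q)
    disjoint        : ∀ q → ¬ (Lower q × Upper q)
    located         : ∀ {q r} → q <ℚ r → Lower q ⊎ Upper r

infix 4 _≤ᴿ_ _∈ᴵ_ _⊆ᴵ_

_≤ᴿ_ : ℝ → ℝ → Set
x ≤ᴿ y = ∀ q → ℝ.Lower x q → ℝ.Lower y q

record Interval : Set₁ where
  constructor [_,_]⟨_⟩
  field
    left right : ℝ
    left≤right : left ≤ᴿ right

_∈ᴵ_ : ℝ → Interval → Set
x ∈ᴵ I = Interval.left I ≤ᴿ x × x ≤ᴿ Interval.right I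

_⊆ᴵ_ : Interval → Interval → Set₁
I ⊆ᴵ J = ∀ x → x ∈ᴵ I → x ∈ᴵ J

Intersects : Interval → Interval → Set₁
Intersects I J = Σ ℝ λ x → x ∈ᴵ I × x ∈ᴵ J

-- Vertices are positions in the list, so a set of k vertices is a sublist of
-- length k.
HasClique : ℕ → List Interval → Set₁
HasClique k Is =
  Σ (List Interval) λ Ks → Ks ⊑ Is × length Ks ≡ k × AllPairs Intersects Ks

Color : Set
Color = ℕ

-- The coloured intervals presented so far, most recent first.
Position : Set₁
Position = List (Interval × Color)

intervals : Position → List Interval
intervals = map proj₁

colorsUsed : Position → ℕ
colorsUsed p = length (deduplicate _≟_ (map proj₂ p))

LegalInterval : ℕ → Position → Interval → Set₁
LegalInterval ω p I =
  All (λ J → ¬ (I ⊆ᴵ J) × ¬ (J ⊆ᴵ I)) (intervals p) ×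
  ¬ HasClique (suc ω) (I ∷ intervals p)

LegalColor : Position → Interval → Color → Set₁
LegalColor p I c = ∀ {J d} → (J , d) ∈ p → Intersects I J → c ≢ d

-- A strategy of Builder from a given position is a well-founded tree: each
-- branch is a finite play, and a node has one subtree for every legal answer
-- of Algorithm.  Algorithm always has a legal answer, as ℕ is infinite, so
-- no node is vacuous.
data ForcesFrom (ω m : ℕ) (p : Position) : Set₁ where
  stop    : m ≤ colorsUsed p → ForcesFrom ω m p
  present : ∀ I → LegalInterval ω p I →
            (∀ c → LegalColor p I c → ForcesFrom ω m ((I , c) ∷ p)) →
            ForcesFrom ω m p

BuilderForces : ℕ → ℕ → Set₁
BuilderForces ω m = ForcesFrom ω m []

-- R[ ω ]= m says that m is the maximum defining R(ω).
R[_]=_ : ℕ → ℕ → Set₁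
R[ ω ]= m = BuilderForces ω m × (∀ k → BuilderForces ω k → k ≤ m)

-- Upper bound: an interval that neither contains nor is contained in I meets I only
-- if it covers one of the two endpoints of I, and each endpoint is covered by at most
-- ω - 1 other intervals, so first fit needs at most 2ω - 1 colours.  Comparing reals
-- is not decidable; the argument runs under a double negation, harmless as k ≤ 7 is
-- decidable.
--
-- Lower bound: an explicit finite strategy tree for Builder with endpoints in ℕ, whose
-- validity is decidable: by Helly's theorem the clique bound only has to be tested at
-- left endpoints.

module Submission where

open import Defs

open import Data.Empty using (⊥; ⊥-elim)
open import Data.Integer using (+_; +≤+)
import Data.Integer.Properties as ℤ
open import Data.List using (List; []; _∷_; length; map; take; upTo; downFrom; filter)
open import Data.List.Membership.Propositional using (_∈_; _∉_; _─_; find)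
open import Data.List.Membership.Propositional.Properties
  using (∈-upTo⁺; ∈-upTo⁻; ∈-downFrom⁺; ∈-filter⁺; ∈-deduplicate⁺)
open import Data.List.Properties using (length-map; length-take; length-upTo; filter-all)
open import Data.List.Relation.Binary.Sublist.Propositional
  using ([]; _∷_; _∷ʳ_; lookup) renaming (_⊆_ to _⊑_; ⊆-trans to ⊑-trans)
open import Data.List.Relation.Binary.Sublist.Propositional.Properties using (take-⊆; filter⁺; length-mono-≤)
open import Data.List.Relation.Unary.All as All using (All; []; _∷_; all?)
import Data.List.Relation.Unary.All.Properties as All
open import Data.List.Relation.Unary.AllPairs as AllPairs using (AllPairs; []; _∷_)
import Data.List.Relation.Unary.AllPairs.Properties as AllPairs
open import Data.List.Relation.Unary.Any using (here; there)
open import Data.List.Relation.Unary.Unique.DecPropositional.Properties using (deduplicate-!)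
open import Data.List.Relation.Unary.Unique.Propositional using (Unique)
open import Data.List.Relation.Unary.Unique.Propositional.Properties using (upTo⁺)
open import Data.Nat using (ℕ; suc; _+_; _⊔_; _≤_; _<_; z≤n; s≤s; _≟_; _≤?_; _<?_)
open import Data.List.Membership.DecPropositional _≟_ using (_∈?_)
open import Data.Nat.Coprimality using (1-coprimeTo) renaming (sym to coprime-sym)
open import Data.Nat.Properties
  using ( ≤-refl; ≤-reflexive; ≤-trans; ≤-total; ≤-pred; ≰⇒>; <-irrefl; <-≤-trans; <⇒≱; n<1+n; m≤n⇒m≤1+n
        ; m≤m+n; +-mono-≤; +-suc; m≤n⇒m⊓n≡m; m≤m⊔n; m≤n⊔m; ⊔-lub )
open import Data.Product using (∃; _×_; _,_; proj₁; proj₂)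
open import Data.Rational using (ℚ; mkℚ; 1ℚ; *≤*)
  renaming (_<_ to _<ℚ_; _≤_ to _≤ℚ_; _+_ to _+ℚ_; -_ to -ℚ_)
import Data.Rational.Properties as ℚ
open import Data.Sum using (_⊎_; inj₁; inj₂; [_,_]′)
open import Data.Unit using (⊤; tt)
open import Function using (_∘_; id)
open import Function.Bundles using (Equivalence; mk⇔)
open import Relation.Binary.Definitions using (tri<; tri≈; tri>)
open import Relation.Binary.PropositionalEquality using (_≡_; _≢_; refl; sym; trans; cong; subst)
open import Relation.Nullary using (¬_; Dec; yes; no; ¬?)
open import Relation.Nullary.Decidable using (decidable-stable; toWitness; True; _×-dec_; _⊎-dec_)

private
  module _ {a} {A : Set a} where

    ∈-─ : ∀ {x y : A} {ys} (x∈ys : x ∈ ys) → y ∈ ys → x ≢ y → y ∈ (ys ─ x∈ys)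
    ∈-─ (here refl)  (here refl)  x≢y = ⊥-elim (x≢y refl)
    ∈-─ (here refl)  (there y∈ys) _   = y∈ys
    ∈-─ (there x∈ys) (here refl)  _   = here refl
    ∈-─ (there x∈ys) (there y∈ys) x≢y = there (∈-─ x∈ys y∈ys x≢y)

    length-─ : ∀ {x : A} {ys} (x∈ys : x ∈ ys) → suc (length (ys ─ x∈ys)) ≡ length ys
    length-─ (here _)           = refl
    length-─ (there x∈ys) = cong suc (length-─ x∈ys)

    Unique-⊆⇒length≤ : ∀ {xs ys : List A} → Unique xs → All (_∈ ys) xs → length xs ≤ length ys
    Unique-⊆⇒length≤ []          []              = z≤n
    Unique-⊆⇒length≤ (x∉xs ∷ uxs) (x∈ys ∷ xs⊆ys) =
      ≤-trans (s≤s (Unique-⊆⇒length≤ uxs (All.zipWith (λ (y∈ys , x≢y) → ∈-─ x∈ys y∈ys x≢y) (xs⊆ys , x∉xs))))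
              (≤-reflexive (length-─ x∈ys))

≤ᴿ-refl : ∀ {x} → x ≤ᴿ x
≤ᴿ-refl _ = id

≤ᴿ-trans : ∀ {x y z} → x ≤ᴿ y → y ≤ᴿ z → x ≤ᴿ z
≤ᴿ-trans x≤y y≤z q = y≤z q ∘ x≤y q

module _ (x : ℝ) where
  open ℝ x

  Lower-<-closed : ∀ {q r} → q <ℚ r → Lower r → Lower q
  Lower-<-closed {q} {r} q<r r∈L = Equivalence.from (lower-rounded q) (r , q<r , r∈L)

  Upper-<-closed : ∀ {q r} → q <ℚ r → Upper q → Upper r
  Upper-<-closed {q} {r} q<r q∈U = Equivalence.from (upper-rounded r) (q , q<r , q∈U)

  Lower<Upper : ∀ {q r} → Lower q → Upper r → q <ℚ r
  Lower<Upper {q} {r} q∈L r∈U with ℚ.<-cmp q r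
  ... | tri< q<r _ _ = q<r
  ... | tri≈ _ refl _ = ⊥-elim (disjoint q (q∈L , r∈U))
  ... | tri> _ _ r<q = ⊥-elim (disjoint q (q∈L , Upper-<-closed r<q r∈U))

≰ᴿ⇒≥ᴿ : ∀ {x y} → ¬ (x ≤ᴿ y) → ¬ ¬ (y ≤ᴿ x)
≰ᴿ⇒≥ᴿ {x} {y} x≰y y≰x = x≰y λ q q∈Lx →
  let r , q<r , r∈Lx = Equivalence.to (ℝ.lower-rounded x q) q∈Lx
  in [ id , (λ r∈Uy → ⊥-elim (y≰x λ s s∈Ly → Lower-<-closed x (Lower<Upper y s∈Ly r∈Uy) r∈Lx)) ]′
     (ℝ.located y q<r)

≤ᴿ-total : ∀ x y → ¬ ¬ (x ≤ᴿ y ⊎ y ≤ᴿ x)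
≤ᴿ-total x y ¬total = ≰ᴿ⇒≥ᴿ {x} {y} (¬total ∘ inj₁) (¬total ∘ inj₂)

open Interval using (left; right; left≤right)

private
  variable
    I J : Interval
    p : Position

data Contact (I J : Interval) : Set₁ where
  apart   : ¬ Intersects I J → Contact I J
  atLeft  : left I ∈ᴵ J → Contact I J
  atRight : right I ∈ᴵ J → Contact I J

contact : ∀ I J → ¬ (J ⊆ᴵ I) → ¬ ¬ Contact I J
contact I J J⊈I ¬contact = ¬contact (apart λ (x , (lI≤x , x≤rI) , lJ≤x , x≤rJ) →
  ≤ᴿ-total (left J) (left I) λ
    { (inj₁ lJ≤lI) → ¬contact (atLeft (lJ≤lI , ≤ᴿ-trans {left I} {x} {right J} lI≤x x≤rJ))
    ; (inj₂ lI≤lJ) → ≤ᴿ-total (right I) (right J) λ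
      { (inj₁ rI≤rJ) → ¬contact (atRight (≤ᴿ-trans {left J} {x} {right I} lJ≤x x≤rI , rI≤rJ))
      ; (inj₂ rJ≤rI) → J⊈I λ y (lJ≤y , y≤rJ) →
          ≤ᴿ-trans {left I} {left J} {y} lI≤lJ lJ≤y , ≤ᴿ-trans {y} {right J} {right I} y≤rJ rJ≤rI
      } })

¬¬-All : ∀ {a p} {A : Set a} {P : A → Set p} {xs} → All (λ x → ¬ ¬ P x) xs → ¬ ¬ All P xs
¬¬-All []         ¬all = ¬all []
¬¬-All (¬¬px ∷ pxs) ¬all = ¬¬px λ px → ¬¬-All pxs (¬all ∘ (px ∷_))

sharing⇒AllPairs : ∀ x {Js} → All (x ∈ᴵ_) Js → AllPairs Intersects Js
sharing⇒AllPairs x []         = []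
sharing⇒AllPairs x (x∈J ∷ x∈Js) = All.map (λ x∈K → x , x∈J , x∈K) x∈Js ∷ sharing⇒AllPairs x x∈Js

sharing≤ : ∀ ω x {Is} → x ∈ᴵ I → ¬ HasClique (suc ω) (I ∷ Is) →
           ∀ {Js} → Js ⊑ Is → All (x ∈ᴵ_) Js → suc (length Js) ≤ ω
sharing≤ {I} ω x x∈I ¬clique {Js} Js⊑Is x∈Js with suc (length Js) ≤? ω
... | yes le = le
... | no ¬le = ⊥-elim (¬clique
      ( I ∷ take ω Js
      , refl ∷ ⊑-trans (take-⊆ ω Js) Js⊑Is
      , cong suc (trans (length-take ω Js) (m≤n⇒m⊓n≡m (≤-pred (≰⇒> ¬le))))
      , sharing⇒AllPairs x (x∈I ∷ All.take⁺ ω x∈Js)))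

record Neighbours (I : Interval) (p : Position) : Set₁ where
  field
    lefts rights  : List Interval
    lefts⊑        : lefts ⊑ intervals p
    rights⊑       : rights ⊑ intervals p
    left-shared   : All (left I ∈ᴵ_) lefts
    right-shared  : All (right I ∈ᴵ_) rights
    forbidden     : List Color
    length-forbidden : length forbidden ≡ length lefts + length rights
    legal         : ∀ {c} → c ∉ forbidden → LegalColor p I c

neighbours : All (Contact I ∘ proj₁) p → Neighbours I p
neighbours [] = record
  { lefts = [] ; rights = [] ; lefts⊑ = [] ; rights⊑ = [] ; left-shared = [] ; right-shared = []
  ; forbidden = [] ; length-forbidden = refl ; legal = λ _ () }
neighbours {p = (J , d) ∷ _} (t ∷ ts) with neighbours ts
... | N with t
...   | apart ¬meet = record
  { lefts = lefts ; rights = rights ; lefts⊑ = J ∷ʳ lefts⊑ ; rights⊑ = J ∷ʳ rights⊑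
  ; left-shared = left-shared ; right-shared = right-shared
  ; forbidden = forbidden ; length-forbidden = length-forbidden
  ; legal = λ { c∉ (here refl) meet → ⊥-elim (¬meet meet) ; c∉ (there J∈p) → legal c∉ J∈p } }
  where open Neighbours N
...   | atLeft l∈J = record
  { lefts = J ∷ lefts ; rights = rights ; lefts⊑ = refl ∷ lefts⊑ ; rights⊑ = J ∷ʳ rights⊑
  ; left-shared = l∈J ∷ left-shared ; right-shared = right-shared
  ; forbidden = d ∷ forbidden ; length-forbidden = cong suc length-forbidden
  ; legal = λ { c∉ (here refl) _ → c∉ ∘ here ; c∉ (there J∈p) → legal (c∉ ∘ there) J∈p } }
  where open Neighbours N
...   | atRight r∈J = record
  { lefts = lefts ; rights = J ∷ rights ; lefts⊑ = J ∷ʳ lefts⊑ ; rights⊑ = refl ∷ rights⊑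
  ; left-shared = left-shared ; right-shared = r∈J ∷ right-shared
  ; forbidden = d ∷ forbidden ; length-forbidden = trans (cong suc length-forbidden) (sym (+-suc _ _))
  ; legal = λ { c∉ (here refl) _ → c∉ ∘ here ; c∉ (there J∈p) → legal (c∉ ∘ there) J∈p } }
  where open Neighbours N

∃-∉ : ∀ n (xs : List ℕ) → length xs < n → ∃ λ c → c < n × c ∉ xs
∃-∉ n xs short =
  let c , c∈upTo , c∉xs = find (All.¬All⇒Any¬ (_∈? xs) (upTo n) ¬all) in c , ∈-upTo⁻ c∈upTo , c∉xs
  where
  ¬all : ¬ All (_∈ xs) (upTo n)
  ¬all all∈ = <-irrefl refl (<-≤-trans short
    (subst (_≤ length xs) (length-upTo n) (Unique-⊆⇒length≤ (upTo⁺ n) all∈)))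

colorsUsed≤ : ∀ n (p : Position) → All (_< n) (map proj₂ p) → colorsUsed p ≤ n
colorsUsed≤ n p p<n = subst (colorsUsed p ≤_) (length-upTo n)
  (Unique-⊆⇒length≤ (deduplicate-! _≟_ (map proj₂ p)) (All.deduplicate⁺ _≟_ (All.map ∈-upTo⁺ p<n)))

first-fit : ∀ ω → LegalInterval (suc ω) p I → ¬ ¬ ∃ λ c → c < suc (ω + ω) × LegalColor p I c
first-fit {p} {I} ω (proper , ¬clique) ¬fit =
  ¬¬-All (All.map (contact I _ ∘ proj₂) (All.map⁻ proper)) λ contacts →
    let open Neighbours (neighbours contacts)
        few = ≤-pred (sharing≤ (suc ω) (left I) (≤ᴿ-refl {left I} , left≤right I) ¬clique lefts⊑ left-shared)
        few′ = ≤-pred (sharing≤ (suc ω) (right I) (left≤right I , ≤ᴿ-refl {right I}) ¬clique rights⊑ right-shared)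
        c , c< , c∉ = ∃-∉ (suc (ω + ω)) forbidden
          (s≤s (≤-trans (≤-reflexive length-forbidden) (+-mono-≤ few few′)))
    in ¬fit (c , c< , legal c∉)

first-fit-bound : ∀ ω {k} → ForcesFrom (suc ω) k p → All (_< suc (ω + ω)) (map proj₂ p) →
                  ¬ ¬ (k ≤ suc (ω + ω))
first-fit-bound ω (stop k≤)             p< ¬k≤ = ¬k≤ (≤-trans k≤ (colorsUsed≤ _ _ p<))
first-fit-bound ω (present I legal next) p< ¬k≤ = first-fit ω legal λ (c , c< , c-legal) →
  first-fit-bound ω (next c c-legal) (c< ∷ p<) ¬k≤

upper-bound : ∀ ω k → BuilderForces (suc ω) k → k ≤ suc (ω + ω)
upper-bound ω k forces = decidable-stable (k ≤? suc (ω + ω)) (first-fit-bound ω forces [])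

fromℚ : ℚ → ℝ
fromℚ x = record
  { Lower           = _<ℚ x
  ; Upper           = x <ℚ_
  ; lower-inhabited = x +ℚ -ℚ 1ℚ , subst (x +ℚ -ℚ 1ℚ <ℚ_) (ℚ.+-identityʳ x) (ℚ.+-monoʳ-< x (ℚ.negative⁻¹ (-ℚ 1ℚ)))
  ; upper-inhabited = x +ℚ 1ℚ , subst (_<ℚ x +ℚ 1ℚ) (ℚ.+-identityʳ x) (ℚ.+-monoʳ-< x (ℚ.positive⁻¹ 1ℚ))
  ; lower-rounded   = λ q → mk⇔ ℚ.<-dense (λ (r , q<r , r<x) → ℚ.<-trans q<r r<x)
  ; upper-rounded   = λ r → mk⇔ (λ x<r → let q , x<q , q<r = ℚ.<-dense x<r in q , q<r , x<q)
                                (λ (q , q<r , x<q) → ℚ.<-trans x<q q<r)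
  ; disjoint        = λ q (q<x , x<q) → ℚ.<-asym q<x x<q
  ; located         = located
  }
  where
  located : ∀ {q r} → q <ℚ r → q <ℚ x ⊎ x <ℚ r
  located {q} q<r with ℚ.<-cmp q x
  ... | tri< q<x _ _  = inj₁ q<x
  ... | tri≈ _ refl _ = inj₂ q<r
  ... | tri> _ _ x<q  = inj₂ (ℚ.<-trans x<q q<r)

fromℚ-mono : ∀ {x y} → x ≤ℚ y → fromℚ x ≤ᴿ fromℚ y
fromℚ-mono x≤y q q<x = ℚ.<-≤-trans q<x x≤y

fromℚ-cancel : ∀ {x y} → fromℚ x ≤ᴿ fromℚ y → x ≤ℚ y
fromℚ-cancel x≤y = ℚ.≮⇒≥ λ y<x → let q , y<q , q<x = ℚ.<-dense y<x in ℚ.<-asym y<q (x≤y q q<x)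

ℕ→ℚ : ℕ → ℚ
ℕ→ℚ n = mkℚ (+ n) 0 (coprime-sym (1-coprimeTo n))

fromℕ : ℕ → ℝ
fromℕ n = fromℚ (ℕ→ℚ n)

fromℕ-mono : ∀ {m n} → m ≤ n → fromℕ m ≤ᴿ fromℕ n
fromℕ-mono {m} {n} m≤n =
  fromℚ-mono {ℕ→ℚ m} {ℕ→ℚ n} (*≤* (ℤ.*-monoʳ-≤-nonNeg (+ 1) (+≤+ m≤n)))

fromℕ-cancel : ∀ {m n} → fromℕ m ≤ᴿ fromℕ n → m ≤ n
fromℕ-cancel {m} {n} m≤n with fromℚ-cancel {ℕ→ℚ m} {ℕ→ℚ n} m≤n
... | *≤* le = ℤ.drop‿+≤+ (ℤ.*-cancelʳ-≤-pos (+ m) (+ n) (+ 1) le)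

record Segment : Set where
  constructor _⟷_
  field
    start size : ℕ

  end : ℕ
  end = start + size

open Segment

private
  variable
    s t : Segment
    ss  : List Segment

_∋_ : Segment → ℕ → Set
s ∋ n = start s ≤ n × n ≤ end s

_∋?_ : ∀ s n → Dec (s ∋ n)
s ∋? n = (start s ≤? n) ×-dec (n ≤? end s)

Meets : Segment → Segment → Set
Meets s t = start s ≤ end t × start t ≤ end s

meets? : ∀ s t → Dec (Meets s t)
meets? s t = (start s ≤? end t) ×-dec (start t ≤? end s)

Before : Segment → Segment → Set
Before s t = start s < start t × end s < end t

before? : ∀ s t → Dec (Before s t)
before? s t = (start s <? start t) ×-dec (end s <? end t)

toInterval : Segment → Interval
toInterval s = [ fromℕ (start s) , fromℕ (end s) ]⟨ fromℕ-mono (m≤m+n (start s) (size s)) ⟩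

toInterval-⊆⁻ : toInterval s ⊆ᴵ toInterval t → start t ≤ start s × end s ≤ end t
toInterval-⊆⁻ {s} {t} s⊆t =
  fromℕ-cancel (proj₁ (s⊆t (fromℕ (start s)) (fromℕ-mono {start s} ≤-refl , fromℕ-mono (m≤m+n (start s) (size s))))) ,
  fromℕ-cancel (proj₂ (s⊆t (fromℕ (end s)) (fromℕ-mono (m≤m+n (start s) (size s)) , fromℕ-mono {end s} ≤-refl)))

Before⇒⊈ : Before s t → ¬ (toInterval s ⊆ᴵ toInterval t) × ¬ (toInterval t ⊆ᴵ toInterval s)
Before⇒⊈ {s} {t} (s<t , s<t′) =
  <⇒≱ s<t ∘ proj₁ ∘ toInterval-⊆⁻ {s} {t} , <⇒≱ s<t′ ∘ proj₂ ∘ toInterval-⊆⁻ {t} {s}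

Intersects⇒Meets : Intersects (toInterval s) (toInterval t) → Meets s t
Intersects⇒Meets {s} {t} (x , (s≤x , x≤s) , (t≤x , x≤t)) =
  fromℕ-cancel (≤ᴿ-trans {fromℕ (start s)} {x} {fromℕ (end t)} s≤x x≤t) ,
  fromℕ-cancel (≤ᴿ-trans {fromℕ (start t)} {x} {fromℕ (end s)} t≤x x≤s)

Meets⇒Intersects : Meets s t → Intersects (toInterval s) (toInterval t)
Meets⇒Intersects {s} {t} (s≤t , t≤s) = fromℕ (start s ⊔ start t) ,
  (fromℕ-mono (m≤m⊔n _ _) , fromℕ-mono (⊔-lub (m≤m+n (start s) _) t≤s)) ,
  (fromℕ-mono (m≤n⊔m (start s) _) , fromℕ-mono (⊔-lub s≤t (m≤m+n (start t) _)))

-- Helly's theorem on the line: the largest left endpoint lies in every segment.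
helly : AllPairs Meets (s ∷ ss) → ∃ λ t → t ∈ s ∷ ss × All (_∋ start t) (s ∷ ss)
helly {s} {[]} _ = s , here refl , (≤-refl , m≤m+n _ _) ∷ []
helly {s} {_ ∷ _} (s-meets ∷ pairs) with helly pairs
... | t , t∈ , all∋ with ≤-total (start s) (start t)
...   | inj₁ s≤t = t , there t∈ , (s≤t , proj₂ (All.lookup s-meets t∈)) ∷ all∋
...   | inj₂ t≤s = s , here refl ,
  (≤-refl , m≤m+n _ _) ∷ All.zipWith (λ ((u≤t , _) , s≤u , _) → ≤-trans u≤t t≤s , s≤u) (all∋ , s-meets)

load : ℕ → List Segment → ℕ
load n ss = length (filter (_∋? n) ss)

⊑-map⁻ : ∀ {a b} {A : Set a} {B : Set b} {f : A → B} xs {ys} → ys ⊑ map f xs →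
         ∃ λ zs → zs ⊑ xs × ys ≡ map f zs
⊑-map⁻ []       []         = [] , [] , refl
⊑-map⁻ (x ∷ xs) (_ ∷ʳ ys⊑) = let zs , zs⊑ , eq = ⊑-map⁻ xs ys⊑ in zs , x ∷ʳ zs⊑ , eq
⊑-map⁻ {f = f} (x ∷ xs) (refl ∷ ys⊑) =
  let zs , zs⊑ , eq = ⊑-map⁻ xs ys⊑ in x ∷ zs , refl ∷ zs⊑ , cong (f x ∷_) eq

load≤⇒¬HasClique : ∀ ω → All (λ s → load (start s) ss ≤ ω) ss → ¬ HasClique (suc ω) (map toInterval ss)
load≤⇒¬HasClique {ss} ω load≤ (_ , Ks⊑ , length≡ , pairs) with ⊑-map⁻ ss Ks⊑
load≤⇒¬HasClique {ss} ω load≤ (_ , Ks⊑ , () , pairs)      | [] , _ , refl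
load≤⇒¬HasClique {ss} ω load≤ (_ , Ks⊑ , length≡ , pairs) | k ∷ ks , ks⊑ , refl
  with helly (AllPairs.map (λ {s} {t} → Intersects⇒Meets {s} {t}) (AllPairs.map⁻ pairs))
... | t , t∈ , all∋ = <-irrefl refl (≤-trans
  (≤-reflexive (trans (sym length≡) (trans (length-map toInterval (k ∷ ks)) (sym (cong length (filter-all (_∋? start t) all∋))))))
  (≤-trans (length-mono-≤ (filter⁺ (_∋? start t) (_∋? start t) (λ { refl → id }) ks⊑)) (All.lookup load≤ (lookup ks⊑ t∈))))

Legal : ℕ → List Segment → Segment → Set
Legal ω ss s = All (λ t → Before s t ⊎ Before t s) ss × All (λ t → load (start t) (s ∷ ss) ≤ ω) (s ∷ ss)

legal? : ∀ ω ss s → Dec (Legal ω ss s)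
legal? ω ss s =
  all? (λ t → before? s t ⊎-dec before? t s) ss ×-dec all? (λ t → load (start t) (s ∷ ss) ≤? ω) (s ∷ ss)

-- The colours played so far are numbered from 0 in order of first use.
Board : Set
Board = List (Segment × ℕ)

segments : Board → List Segment
segments = map proj₁

Free : Board → Segment → ℕ → Set
Free b s k = All (λ (t , l) → ¬ (Meets s t × k ≡ l)) b

free? : ∀ b s k → Dec (Free b s k)
free? b s k = all? (λ (t , l) → ¬? (meets? s t ×-dec (k ≟ l))) b

-- In node s t ts, t answers a fresh colour for s and ts the old colours that
-- are still free for s, latest first.
data Tree : Set where
  done : Tree
  node : Segment → Tree → List Tree → Tree

play : ℕ → ℕ → Tree → List Tree → Tree
play a ℓ = node (a ⟷ ℓ)

force : ℕ → ℕ → Tree → Tree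
force a ℓ t = play a ℓ t []

win : ℕ → ℕ → Tree
win a ℓ = force a ℓ done

module _ (ω m : ℕ) where

  mutual
    Wins : ℕ → Board → Tree → Set
    Wins u b done          = m ≤ u
    Wins u b (node s t ts) =
      Legal ω (segments b) s × Wins (suc u) ((s , u) ∷ b) t ×
      WinsAll u b s (filter (free? b s) (downFrom u)) ts

    WinsAll : ℕ → Board → Segment → List ℕ → List Tree → Set
    WinsAll u b s []       _        = ⊤
    WinsAll u b s (k ∷ ks) []       = ⊥
    WinsAll u b s (k ∷ ks) (t ∷ ts) = Wins u ((s , k) ∷ b) t × WinsAll u b s ks ts

  mutual
    wins? : ∀ u b t → Dec (Wins u b t)
    wins? u b done          = m ≤? u
    wins? u b (node s t ts) =
      legal? ω (segments b) s ×-dec (wins? (suc u) ((s , u) ∷ b) t ×-dec winsAll? u b s _ ts)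

    winsAll? : ∀ u b s ks ts → Dec (WinsAll u b s ks ts)
    winsAll? u b s []       _        = yes tt
    winsAll? u b s (k ∷ ks) []       = no λ ()
    winsAll? u b s (k ∷ ks) (t ∷ ts) = wins? u ((s , k) ∷ b) t ×-dec winsAll? u b s ks ts

data _at_is_ : List Color → ℕ → Color → Set where
  latest  : ∀ {c cs} → (c ∷ cs) at length cs is c
  earlier : ∀ {c d cs k} → cs at k is c → (d ∷ cs) at k is c

at⇒< : ∀ {cs k c} → cs at k is c → k < length cs
at⇒< latest      = n<1+n _
at⇒< (earlier i) = m≤n⇒m≤1+n (at⇒< i)

at-unique : ∀ {cs k c d} → cs at k is c → cs at k is d → c ≡ d
at-unique latest      latest      = refl
at-unique latest      (earlier j) = ⊥-elim (<-irrefl refl (at⇒< j))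
at-unique (earlier i) latest      = ⊥-elim (<-irrefl refl (at⇒< i))
at-unique (earlier i) (earlier j) = at-unique i j

∈⇒at : ∀ {cs c} → c ∈ cs → ∃ λ k → cs at k is c
∈⇒at (here refl) = _ , latest
∈⇒at (there c∈)  = let k , i = ∈⇒at c∈ in k , earlier i

data Realises (cs : List Color) : Board → Position → Set₁ where
  []  : Realises cs [] []
  _∷_ : ∀ {s k c b p} → cs at k is c → Realises cs b p →
        Realises cs ((s , k) ∷ b) ((toInterval s , c) ∷ p)

Realises-earlier : ∀ {cs d b} → Realises cs b p → Realises (d ∷ cs) b p
Realises-earlier []       = []
Realises-earlier (i ∷ re) = earlier i ∷ Realises-earlier re

Realises⇒intervals : ∀ {cs b} → Realises cs b p → intervals p ≡ map toInterval (segments b)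
Realises⇒intervals []       = refl
Realises⇒intervals (_ ∷ re) = cong (_ ∷_) (Realises⇒intervals re)

LegalColor⇒Free : ∀ {cs b s k c} → Realises cs b p → cs at k is c → LegalColor p (toInterval s) c → Free b s k
LegalColor⇒Free         []       _ _     = []
LegalColor⇒Free {s = s} (_∷_ {t} j re) i legal =
  (λ { (meets , refl) → legal (here refl) (Meets⇒Intersects {s} {t} meets) (at-unique i j) }) ∷
  LegalColor⇒Free {s = s} re i (legal ∘ there)

Legal⇒LegalInterval : ∀ {ω cs b} → Realises cs b p → Legal ω (segments b) s → LegalInterval ω p (toInterval s)
Legal⇒LegalInterval {p} {s} {ω} {b = b} re (proper , load≤) rewrite Realises⇒intervals re =
  All.map⁺ (All.map (λ {t} → λ
    { (inj₁ s<t) → Before⇒⊈ {s} {t} s<t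
    ; (inj₂ t<s) → let t⊈s , s⊈t = Before⇒⊈ {t} {s} t<s in s⊈t , t⊈s }) proper) ,
  load≤⇒¬HasClique {s ∷ segments b} ω load≤

module _ {ω m : ℕ} where

  mutual
    Wins⇒ForcesFrom : ∀ t {cs b} → Unique cs → All (_∈ map proj₂ p) cs → Realises cs b p →
                      Wins ω m (length cs) b t → ForcesFrom ω m p
    Wins⇒ForcesFrom done cs! cs⊆p re m≤ =
      stop (≤-trans m≤ (Unique-⊆⇒length≤ cs! (All.map (∈-deduplicate⁺ _≟_) cs⊆p)))
    Wins⇒ForcesFrom {p} (node s t ts) {cs} {b} cs! cs⊆p re (legal , fresh , old) =
      present (toInterval s) (Legal⇒LegalInterval re legal) answer
      where
      answer : ∀ c → LegalColor p (toInterval s) c → ForcesFrom ω m ((toInterval s , c) ∷ p)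
      answer c c-legal with c ∈? cs
      ... | yes c∈ = let k , i = ∈⇒at c∈ in
        WinsAll⇒ForcesFrom ts cs! cs⊆p re i old
          (∈-filter⁺ (free? b s) (∈-downFrom⁺ (at⇒< i)) (LegalColor⇒Free {s = s} re i c-legal))
      ... | no c∉ =
        Wins⇒ForcesFrom t (All.¬Any⇒All¬ cs c∉ ∷ cs!) (here refl ∷ All.map there cs⊆p)
          (latest ∷ Realises-earlier re) fresh

    WinsAll⇒ForcesFrom : ∀ ts {cs b s ks k c} → Unique cs → All (_∈ map proj₂ p) cs → Realises cs b p →
                         cs at k is c → WinsAll ω m (length cs) b s ks ts → k ∈ ks →
                         ForcesFrom ω m ((toInterval s , c) ∷ p)
    WinsAll⇒ForcesFrom (t ∷ _)  cs! cs⊆p re i (wins , _) (here refl) =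
      Wins⇒ForcesFrom t cs! (All.map there cs⊆p) (i ∷ re) wins
    WinsAll⇒ForcesFrom (_ ∷ ts) cs! cs⊆p re i (_ , wins) (there k∈) =
      WinsAll⇒ForcesFrom ts cs! cs⊆p re i wins k∈

  winning : ∀ t → True (wins? ω m 0 [] t) → BuilderForces ω m
  winning t = Wins⇒ForcesFrom t [] [] [] ∘ toWitness

-- afterc₁…cₙ is what Builder does once Algorithm has answered c₁,…,cₙ.  The tree
-- comes from a computer search over the orders of the endpoints.
after0123452 : Tree
after0123452 =
  play 102 19 done (play 126 19 done (play 106 18 done (win 37 70 ∷ play 37 66 done (win 39 68 ∷
  []) ∷ play 104 19 done (win 37 68 ∷ play 37 66 done (win 39 66 ∷ []) ∷ play 112 15 done (win 122
  8 ∷ []) ∷ []) ∷ play 104 19 done (win 37 68 ∷ play 37 66 done (win 39 66 ∷ []) ∷ play 112 15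
  done (win 122 8 ∷ []) ∷ []) ∷ []) ∷ play 106 22 done (win 37 70 ∷ play 37 66 done (win 39 68 ∷
  []) ∷ play 104 23 done (win 37 68 ∷ play 37 66 done (win 39 66 ∷ []) ∷ []) ∷ []) ∷ play 106 22
  done (win 37 70 ∷ play 37 66 done (win 39 68 ∷ []) ∷ play 104 23 done (win 37 68 ∷ play 37 66
  done (win 39 66 ∷ []) ∷ []) ∷ []) ∷ []) ∷ play 122 21 done (play 105 19 done (win 37 69 ∷ play
  103 20 done (win 37 67 ∷ win 112 18 ∷ []) ∷ play 103 20 done (win 37 67 ∷ win 112 18 ∷ []) ∷ [])
  ∷ play 105 19 done (win 37 69 ∷ play 37 66 done (win 39 67 ∷ []) ∷ play 103 20 done (win 37 67 ∷
  win 112 18 ∷ []) ∷ []) ∷ play 105 19 done (win 37 69 ∷ play 37 66 done (win 39 67 ∷ []) ∷ play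
  103 20 done (win 37 67 ∷ win 112 18 ∷ []) ∷ []) ∷ []) ∷ play 37 58 done (play 104 26 done (win
  39 66 ∷ play 94 19 done (win 39 64 ∷ win 112 31 ∷ []) ∷ play 44 61 done (win 39 64 ∷ []) ∷ []) ∷
  play 114 17 done (play 104 18 done (win 39 66 ∷ play 94 19 done (win 39 64 ∷ win 112 18 ∷ []) ∷
  play 44 61 done (win 39 64 ∷ []) ∷ []) ∷ play 94 22 done (win 39 64 ∷ win 115 28 ∷ []) ∷ play 94
  22 done (win 39 64 ∷ win 115 28 ∷ []) ∷ []) ∷ []) ∷ play 98 17 done (play 118 25 done (play 100
  17 done (win 37 64 ∷ play 37 62 done (win 39 62 ∷ []) ∷ play 112 14 done (win 116 14 ∷ []) ∷ [])
  ∷ play 112 14 done (play 39 61 done (win 37 62 ∷ win 99 20 ∷ []) ∷ play 99 20 done (win 37 63 ∷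
  []) ∷ []) ∷ []) ∷ play 116 27 done (play 99 18 done (win 37 63 ∷ win 112 18 ∷ []) ∷ play 99 18
  done (win 37 63 ∷ win 112 18 ∷ []) ∷ []) ∷ play 37 58 done (play 94 19 done (win 39 60 ∷ win 112
  31 ∷ []) ∷ play 94 19 done (win 39 60 ∷ win 112 31 ∷ []) ∷ []) ∷ play 37 58 done (play 44 55
  done (play 94 19 done (win 112 31 ∷ []) ∷ play 112 18 done (win 94 19 ∷ win 113 30 ∷ []) ∷ []) ∷
  play 96 17 done (play 44 55 done (win 39 58 ∷ []) ∷ play 114 29 done (win 112 18 ∷ []) ∷ win 112
  31 ∷ []) ∷ []) ∷ []) ∷ play 117 26 done (play 95 19 done (play 97 19 done (win 37 61 ∷ play 37
  59 done (win 39 59 ∷ []) ∷ play 112 14 done (win 115 15 ∷ []) ∷ []) ∷ play 96 22 done (win 37 60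
  ∷ win 112 18 ∷ []) ∷ play 37 57 done (play 39 57 done (win 44 59 ∷ []) ∷ play 39 57 done (win 44
  59 ∷ []) ∷ []) ∷ play 37 60 done (play 96 22 done (win 112 18 ∷ []) ∷ play 112 14 done (win 96
  22 ∷ win 113 17 ∷ []) ∷ []) ∷ []) ∷ play 96 23 done (play 98 22 done (win 37 62 ∷ play 37 60
  done (win 39 60 ∷ []) ∷ []) ∷ play 98 22 done (win 37 62 ∷ play 37 60 done (win 39 60 ∷ []) ∷
  []) ∷ play 94 24 done (play 37 58 done (win 39 58 ∷ []) ∷ play 37 58 done (win 39 58 ∷ []) ∷ [])
  ∷ []) ∷ []) ∷ [])

after012343 : Tree
after012343 =
  play 41 57 (play 135 15 done (play 96 35 done (win 37 60 ∷ play 94 36 done (win 37 58 ∷ win 99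
  44 ∷ []) ∷ play 94 36 done (win 37 58 ∷ win 99 44 ∷ []) ∷ []) ∷ play 132 17 done (play 99 34
  done (play 102 32 done (play 44 57 done (win 42 58 ∷ win 94 36 ∷ []) ∷ play 42 58 done (win 44
  59 ∷ []) ∷ []) ∷ play 96 35 done (win 37 60 ∷ play 94 36 done (win 37 58 ∷ []) ∷ []) ∷ play 101
  33 done (play 44 56 done (win 37 57 ∷ win 45 57 ∷ []) ∷ play 94 36 done (win 37 58 ∷ []) ∷ []) ∷
  []) ∷ play 96 38 done (win 37 60 ∷ play 94 39 done (win 37 58 ∷ []) ∷ []) ∷ play 96 38 done (win
  37 60 ∷ play 94 39 done (win 37 58 ∷ []) ∷ []) ∷ []) ∷ play 94 42 done (win 37 58 ∷ win 95 48 ∷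
  []) ∷ play 94 42 done (win 37 58 ∷ win 95 48 ∷ []) ∷ [])) (play 102 42 (play 105 40 done (play
  44 60 done (win 42 61 ∷ win 94 36 ∷ []) ∷ play 42 61 done (win 44 62 ∷ []) ∷ [])) (play 99 44
  (play 44 57 done (win 42 58 ∷ win 94 36 ∷ [])) (force 94 36 (win 37 58) ∷ []) ∷ play 99 44 (play
  42 58 done (win 44 59 ∷ [])) (force 94 36 (win 37 58) ∷ []) ∷ []) ∷ play 3 37 (play 102 42 done
  (play 104 41 done (play 95 17 done (win 42 61 ∷ play 44 59 done (win 39 55 ∷ []) ∷ []) ∷ play 42
  61 done (win 44 61 ∷ []) ∷ []) ∷ play 95 17 done (play 44 56 done (win 39 55 ∷ win 99 44 ∷ []) ∷
  win 39 57 ∷ play 44 56 done (win 99 44 ∷ win 39 55 ∷ []) ∷ []) ∷ play 42 59 done (play 99 31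
  done (win 44 59 ∷ win 100 43 ∷ []) ∷ play 104 41 done (win 44 61 ∷ play 44 59 done (win 99 31 ∷
  []) ∷ []) ∷ []) ∷ [])) (play 103 41 (play 105 40 done (play 99 31 done (win 42 62 ∷ play 44 56
  done (win 39 55 ∷ win 45 59 ∷ []) ∷ []) ∷ play 42 62 done (win 44 62 ∷ []) ∷ [])) (play 101 42
  (play 99 31 done (win 42 60 ∷ play 44 56 done (win 39 55 ∷ win 45 57 ∷ []) ∷ [])) (play 95 17
  (win 39 57) (force 44 58 (win 39 55) ∷ []) ∷ []) ∷ play 44 60 (win 39 55) (play 105 40 (win 45
  61) (force 99 31 (win 42 58) ∷ []) ∷ []) ∷ []) ∷ play 104 40 (play 44 57 done (play 99 31 done
  (win 42 58 ∷ play 57 46 done (win 39 19 ∷ win 102 41 ∷ []) ∷ play 57 46 done (win 39 19 ∷ win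
  102 41 ∷ []) ∷ []) ∷ play 102 41 done (play 57 46 done (win 39 19 ∷ win 99 31 ∷ []) ∷ win 45 60
  ∷ []) ∷ play 99 31 done (win 45 60 ∷ win 100 43 ∷ []) ∷ [])) (play 44 57 (play 57 48 done (win
  39 19 ∷ win 99 44 ∷ [])) (play 45 58 (play 102 41 done (win 99 31 ∷ [])) (force 102 41 (win 99
  31) ∷ []) ∷ play 39 19 (play 99 31 done (win 100 43 ∷ win 57 48 ∷ [])) (force 57 48 (win 99 44)
  ∷ []) ∷ []) ∷ play 42 59 (play 99 31 done (win 44 61 ∷ win 100 43 ∷ [])) (play 106 39 (win 44
  63) (force 44 61 (win 99 31) ∷ []) ∷ []) ∷ []) ∷ []) ∷ [])

after012342 : Tree
after012342 =
  play 104 17 (play 108 16 done (win 37 72 ∷ play 39 70 done (win 37 68 ∷ []) ∷ play 146 15 done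
  (play 122 25 done (play 105 18 done (win 37 69 ∷ win 112 31 ∷ []) ∷ play 105 18 done (win 37 69
  ∷ win 112 31 ∷ []) ∷ []) ∷ play 94 19 done (win 37 68 ∷ play 112 31 done (win 114 33 ∷ []) ∷ win
  112 35 ∷ []) ∷ play 144 16 done (play 112 31 done (play 105 18 done (win 37 69 ∷ win 122 23 ∷
  []) ∷ play 105 18 done (win 37 69 ∷ win 122 23 ∷ []) ∷ []) ∷ play 106 16 done (win 37 70 ∷ play
  37 68 done (win 39 68 ∷ []) ∷ win 112 33 ∷ []) ∷ play 94 19 done (win 37 68 ∷ win 112 33 ∷ play
  112 31 done (win 114 31 ∷ []) ∷ []) ∷ []) ∷ play 94 19 done (win 37 68 ∷ win 112 35 ∷ play 114
  33 done (win 112 31 ∷ []) ∷ []) ∷ []) ∷ play 146 15 done (play 122 25 done (play 105 18 done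
  (win 37 69 ∷ win 112 31 ∷ []) ∷ play 105 18 done (win 37 69 ∷ win 112 31 ∷ []) ∷ []) ∷ play 106
  16 done (win 37 70 ∷ play 37 68 done (win 39 68 ∷ []) ∷ win 112 35 ∷ []) ∷ play 94 19 done (win
  37 68 ∷ win 112 35 ∷ play 114 33 done (win 112 31 ∷ []) ∷ []) ∷ play 144 16 done (play 112 31
  done (play 105 18 done (win 37 69 ∷ win 122 23 ∷ []) ∷ play 105 18 done (win 37 69 ∷ win 122 23
  ∷ []) ∷ []) ∷ play 106 16 done (win 37 70 ∷ play 37 68 done (win 39 68 ∷ []) ∷ win 112 33 ∷ [])
  ∷ play 94 19 done (win 37 68 ∷ win 112 33 ∷ play 112 31 done (win 114 31 ∷ []) ∷ []) ∷ []) ∷ [])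
  ∷ [])) (play 124 20 (play 122 21 done (play 107 18 done (play 105 18 done (win 37 69 ∷ win 112
  18 ∷ []) ∷ play 105 18 done (win 37 69 ∷ win 112 18 ∷ []) ∷ []) ∷ play 107 18 done (play 37 68
  done (win 39 69 ∷ []) ∷ play 105 18 done (win 37 69 ∷ win 112 18 ∷ []) ∷ []) ∷ play 107 18 done
  (play 37 68 done (win 39 69 ∷ []) ∷ play 105 18 done (win 37 69 ∷ win 112 18 ∷ []) ∷ []) ∷ []))
  (play 126 19 (play 107 20 done (play 105 20 done (win 37 69 ∷ win 112 18 ∷ []) ∷ play 105 20
  done (win 37 69 ∷ win 112 18 ∷ []) ∷ [])) (play 107 21 (win 37 71) (force 105 22 (win 37 69) ∷
  []) ∷ play 107 21 (win 37 71) (force 105 22 (win 37 69) ∷ []) ∷ []) ∷ play 126 19 (play 107 20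
  done (play 37 68 done (win 39 69 ∷ []) ∷ play 105 20 done (win 37 69 ∷ win 112 18 ∷ []) ∷ []))
  (play 107 21 (win 37 71) (force 105 22 (win 37 69) ∷ []) ∷ play 107 21 (win 37 71) (force 105 22
  (win 37 69) ∷ []) ∷ []) ∷ play 126 19 (play 107 20 done (play 37 68 done (win 39 69 ∷ []) ∷ play
  105 20 done (win 37 69 ∷ win 112 18 ∷ []) ∷ [])) (play 107 21 (win 37 71) (force 105 22 (win 37
  69) ∷ []) ∷ play 107 21 (win 37 71) (force 105 22 (win 37 69) ∷ []) ∷ []) ∷ []) ∷ play 39 66
  (play 114 30 done (play 106 16 done (win 40 67 ∷ play 94 19 done (win 37 58 ∷ win 112 31 ∷ []) ∷
  play 37 57 done (win 44 63 ∷ []) ∷ []) ∷ play 112 31 done (play 106 16 done (win 40 67 ∷ play 44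
  63 done (win 37 57 ∷ []) ∷ []) ∷ play 94 21 done (win 37 58 ∷ []) ∷ []) ∷ play 116 29 done (play
  106 16 done (win 40 67 ∷ play 94 21 done (win 37 58 ∷ []) ∷ []) ∷ play 94 23 done (win 37 58 ∷
  []) ∷ []) ∷ [])) (play 108 36 (win 40 69) (play 106 37 (win 40 67) (force 44 63 (win 37 57) ∷
  []) ∷ force 37 57 (win 44 65) ∷ []) ∷ []) ∷ play 40 58 (play 96 20 done (win 37 60 ∷ play 114 30
  done (play 94 19 done (win 37 58 ∷ win 112 31 ∷ []) ∷ play 37 58 done (win 94 21 ∷ []) ∷ []) ∷
  play 114 30 done (play 94 19 done (win 37 58 ∷ win 112 31 ∷ []) ∷ play 37 58 done (win 94 21 ∷
  []) ∷ []) ∷ [])) (play 96 20 (win 37 60) (play 114 30 (play 94 19 done (win 37 58 ∷ win 112 31 ∷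
  [])) (force 37 58 (win 94 21) ∷ []) ∷ play 114 30 (play 94 19 done (win 37 58 ∷ win 112 31 ∷
  [])) (force 37 58 (win 94 21) ∷ []) ∷ []) ∷ play 117 27 (play 101 13 done (play 112 18 done
  (play 44 59 done (win 41 61 ∷ win 94 19 ∷ []) ∷ play 102 14 done (win 41 62 ∷ win 115 28 ∷ []) ∷
  play 94 19 done (win 41 61 ∷ []) ∷ []) ∷ play 115 28 done (play 102 14 done (win 41 62 ∷ win 112
  18 ∷ []) ∷ play 102 14 done (win 41 62 ∷ win 112 18 ∷ []) ∷ []) ∷ play 44 59 done (play 99 14
  done (win 41 59 ∷ win 112 31 ∷ []) ∷ play 102 16 done (win 112 31 ∷ []) ∷ play 112 18 done (win
  102 16 ∷ win 113 30 ∷ []) ∷ []) ∷ play 44 59 done (play 99 14 done (win 41 59 ∷ win 112 31 ∷ [])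
  ∷ play 102 16 done (win 112 31 ∷ []) ∷ []) ∷ [])) (play 99 19 (play 94 19 done (win 41 59 ∷ win
  112 31 ∷ [])) (play 101 18 (win 41 61) (force 44 58 (win 41 59) ∷ []) ∷ play 39 56 (play 96 17
  done (win 112 31 ∷ win 44 56 ∷ [])) (force 94 19 (win 112 31) ∷ []) ∷ []) ∷ play 119 26 (play 39
  56 done (play 94 24 done (win 96 24 ∷ []) ∷ win 94 26 ∷ [])) (play 94 24 (play 99 21 done (win
  41 59 ∷ [])) (force 99 21 (win 41 59) ∷ []) ∷ []) ∷ []) ∷ []) ∷ play 40 58 (play 96 20 done (win
  37 60 ∷ play 37 57 done (win 44 61 ∷ []) ∷ play 114 30 done (play 94 19 done (win 37 58 ∷ win
  112 31 ∷ []) ∷ play 37 58 done (win 94 21 ∷ []) ∷ []) ∷ [])) (play 96 20 (win 37 60) (force 37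
  57 (win 44 61) ∷ play 114 30 (play 94 19 done (win 37 58 ∷ win 112 31 ∷ [])) (force 37 58 (win
  94 21) ∷ []) ∷ []) ∷ play 117 27 (play 41 60 done (play 106 16 done (win 44 63 ∷ play 99 14 done
  (win 44 61 ∷ win 112 31 ∷ []) ∷ play 99 14 done (win 44 61 ∷ win 112 31 ∷ []) ∷ []) ∷ play 112
  31 done (play 99 14 done (win 44 61 ∷ win 100 18 ∷ []) ∷ win 94 24 ∷ []) ∷ [])) (play 96 18
  (play 99 19 done (win 41 59 ∷ win 112 31 ∷ [])) (play 97 19 (play 115 28 done (win 112 18 ∷ []))
  (force 115 28 (win 112 18) ∷ []) ∷ play 39 56 (play 112 18 done (win 113 30 ∷ win 94 19 ∷ []))
  (force 94 19 (win 112 31) ∷ []) ∷ []) ∷ play 112 31 (play 39 56 done (play 96 22 done (win 44 61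
  ∷ []) ∷ win 94 24 ∷ [])) (play 99 19 (play 41 59 done (win 44 61 ∷ [])) (force 41 59 (win 44 61)
  ∷ []) ∷ []) ∷ []) ∷ []) ∷ [])

after01234 : Tree
after01234 =
  play 129 19 (play 125 19 done (play 39 59 done (play 96 31 done (win 37 60 ∷ play 94 32 done
  (win 37 58 ∷ win 99 44 ∷ []) ∷ play 94 32 done (win 37 58 ∷ win 99 44 ∷ []) ∷ []) ∷ play 99 44
  done (play 94 32 done (win 37 58 ∷ win 95 35 ∷ []) ∷ play 94 32 done (win 37 58 ∷ win 95 35 ∷
  []) ∷ []) ∷ play 101 26 done (play 105 38 done (play 103 25 done (win 40 64 ∷ play 40 62 done
  (win 44 60 ∷ []) ∷ []) ∷ play 40 62 done (win 44 62 ∷ []) ∷ []) ∷ play 104 27 done (play 44 59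
  done (win 40 62 ∷ win 102 28 ∷ []) ∷ play 40 62 done (win 44 61 ∷ []) ∷ []) ∷ play 57 46 done
  (play 99 27 done (win 40 60 ∷ win 104 39 ∷ []) ∷ play 104 39 done (win 102 28 ∷ []) ∷ win 102 41
  ∷ []) ∷ play 44 59 done (play 99 27 done (win 40 60 ∷ win 104 39 ∷ []) ∷ play 104 39 done (win
  102 28 ∷ []) ∷ []) ∷ []) ∷ []) ∷ after0123452 ∷ play 39 58 done (play 95 31 done (win 37 59 ∷
  play 44 55 done (win 37 57 ∷ win 98 45 ∷ []) ∷ play 44 55 done (win 37 57 ∷ win 98 45 ∷ []) ∷
  []) ∷ play 98 45 done (play 94 32 done (win 40 59 ∷ win 95 35 ∷ []) ∷ play 94 32 done (win 37 58
  ∷ win 95 35 ∷ []) ∷ []) ∷ play 44 58 done (play 100 27 done (win 40 61 ∷ play 98 28 done (win 40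
  59 ∷ win 103 40 ∷ []) ∷ play 98 28 done (win 40 59 ∷ win 103 40 ∷ []) ∷ []) ∷ play 103 40 done
  (play 98 28 done (win 40 59 ∷ win 99 31 ∷ []) ∷ win 94 36 ∷ []) ∷ win 94 49 ∷ []) ∷ []) ∷ play
  96 31 done (play 100 43 done (play 37 60 done (win 39 62 ∷ []) ∷ play 98 30 done (win 37 62 ∷
  play 37 60 done (win 39 60 ∷ []) ∷ []) ∷ []) ∷ play 99 32 done (play 37 60 done (win 39 61 ∷ [])
  ∷ play 39 59 done (win 37 60 ∷ win 97 33 ∷ []) ∷ []) ∷ play 37 58 done (play 94 32 done (win 39
  58 ∷ win 97 46 ∷ []) ∷ play 94 32 done (win 39 58 ∷ win 97 46 ∷ []) ∷ []) ∷ play 39 59 done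
  (play 94 32 done (win 37 58 ∷ win 99 44 ∷ []) ∷ play 99 44 done (win 97 33 ∷ []) ∷ win 97 46 ∷
  []) ∷ []) ∷ [])) (after012343 ∷ after012342 ∷ play 100 44 (play 95 35 done (win 37 64 ∷ play 37
  57 done (play 44 53 done (win 39 57 ∷ win 96 47 ∷ []) ∷ win 39 62 ∷ []) ∷ play 44 53 done (play
  45 54 done (win 37 57 ∷ win 98 45 ∷ []) ∷ play 45 54 done (win 37 57 ∷ win 98 45 ∷ []) ∷ win 96
  47 ∷ []) ∷ [])) (play 37 58 (play 44 58 done (win 39 62 ∷ win 94 49 ∷ [])) (play 102 43 (win 39
  64) (force 94 36 (win 39 62) ∷ []) ∷ []) ∷ play 96 35 (play 39 59 done (win 37 60 ∷ win 97 46 ∷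
  [])) (play 98 34 (win 37 62) (force 37 60 (win 39 60) ∷ []) ∷ play 94 36 (play 37 58 done (win
  39 58 ∷ [])) (force 37 58 (win 39 58) ∷ []) ∷ []) ∷ []) ∷ play 138 12 (play 96 35 done (play 100
  43 done (play 37 60 done (win 39 62 ∷ []) ∷ play 98 34 done (win 37 62 ∷ play 37 60 done (win 39
  60 ∷ []) ∷ []) ∷ []) ∷ play 99 41 done (play 37 60 done (win 39 61 ∷ []) ∷ play 39 59 done (win
  37 60 ∷ win 97 42 ∷ []) ∷ []) ∷ play 37 58 done (play 94 36 done (win 39 58 ∷ win 97 46 ∷ []) ∷
  play 94 36 done (win 39 58 ∷ win 97 46 ∷ []) ∷ []) ∷ play 39 59 done (play 94 36 done (win 37 58
  ∷ win 99 44 ∷ []) ∷ play 99 44 done (win 97 42 ∷ []) ∷ win 97 46 ∷ []) ∷ [])) (play 39 57 (play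
  94 45 done (win 37 58 ∷ win 95 48 ∷ [])) (play 97 46 (play 94 36 done (win 40 58 ∷ win 95 44 ∷
  [])) (force 94 45 (win 37 58) ∷ []) ∷ play 99 41 (play 94 36 done (win 40 60 ∷ win 100 43 ∷ []))
  (play 101 40 (win 40 62) (force 94 36 (win 40 60) ∷ []) ∷ play 94 36 (win 100 43) (force 97 42
  (win 40 58) ∷ []) ∷ []) ∷ []) ∷ play 100 34 (play 104 39 done (play 37 64 done (win 39 66 ∷ [])
  ∷ play 102 33 done (win 37 66 ∷ play 37 64 done (win 39 64 ∷ []) ∷ []) ∷ [])) (play 135 14 (play
  103 34 done (play 37 64 done (win 39 65 ∷ []) ∷ play 39 63 done (win 37 64 ∷ win 101 35 ∷ []) ∷
  [])) (play 103 34 (win 37 67) (force 101 35 (win 37 65) ∷ []) ∷ play 103 34 (win 37 67) (force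
  101 35 (win 37 65) ∷ []) ∷ []) ∷ play 131 18 (play 37 59 done (play 102 33 done (win 39 64 ∷
  play 94 36 done (win 39 62 ∷ []) ∷ []) ∷ play 94 36 done (win 39 62 ∷ win 95 37 ∷ []) ∷ []))
  (play 94 38 (play 37 58 done (win 39 62 ∷ [])) (force 37 58 (win 39 62) ∷ []) ∷ []) ∷ play 96 35
  (play 98 34 done (win 37 62 ∷ play 37 60 done (win 39 60 ∷ []) ∷ [])) (play 132 17 (play 39 59
  done (win 37 60 ∷ win 97 36 ∷ [])) (force 97 36 (win 37 61) ∷ []) ∷ play 94 36 (play 37 58 done
  (win 39 58 ∷ [])) (force 37 58 (win 39 58) ∷ []) ∷ []) ∷ []) ∷ play 40 57 (play 94 45 done (win
  37 58 ∷ win 95 48 ∷ [])) (play 41 58 (play 98 45 done (win 94 45 ∷ [])) (force 98 45 (win 94 45)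
  ∷ []) ∷ play 39 56 (win 94 49) (force 96 47 (win 94 45) ∷ []) ∷ []) ∷ []) ∷ [])

after01233 : Tree
after01233 =
  play 41 57 (play 150 12 (play 148 13 done (play 96 48 done (win 37 60 ∷ play 94 49 done (win 37
  58 ∷ win 99 52 ∷ []) ∷ play 94 49 done (win 37 58 ∷ win 99 52 ∷ []) ∷ []) ∷ play 145 15 done
  (play 99 47 done (play 102 45 done (play 44 57 done (win 42 58 ∷ win 94 49 ∷ []) ∷ play 42 58
  done (win 44 59 ∷ []) ∷ []) ∷ play 96 48 done (win 37 60 ∷ play 94 49 done (win 37 58 ∷ []) ∷
  []) ∷ play 101 46 done (play 44 56 done (win 37 57 ∷ win 45 57 ∷ []) ∷ play 94 49 done (win 37
  58 ∷ []) ∷ []) ∷ []) ∷ play 96 51 done (win 37 60 ∷ play 94 52 done (win 37 58 ∷ []) ∷ []) ∷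
  play 96 51 done (win 37 60 ∷ play 94 52 done (win 37 58 ∷ []) ∷ []) ∷ []) ∷ play 94 55 done (win
  37 58 ∷ win 95 56 ∷ []) ∷ play 94 55 done (win 37 58 ∷ win 95 56 ∷ []) ∷ [])) (play 102 50 (play
  105 48 done (play 44 60 done (win 42 61 ∷ win 94 49 ∷ []) ∷ play 42 61 done (win 44 62 ∷ []) ∷
  [])) (play 99 52 (play 44 57 done (win 42 58 ∷ win 94 49 ∷ [])) (force 94 49 (win 37 58) ∷ []) ∷
  play 99 52 (play 42 58 done (win 44 59 ∷ [])) (force 94 49 (win 37 58) ∷ []) ∷ []) ∷ play 146 15
  (play 96 49 done (win 37 60 ∷ play 144 16 done (play 94 49 done (win 37 58 ∷ win 99 48 ∷ []) ∷
  win 97 50 ∷ []) ∷ play 144 16 done (play 94 49 done (win 37 58 ∷ win 99 48 ∷ []) ∷ win 97 50 ∷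
  []) ∷ [])) (play 99 48 (play 102 46 done (play 44 57 done (win 42 58 ∷ win 94 49 ∷ []) ∷ play 42
  58 done (win 44 59 ∷ []) ∷ [])) (play 144 16 (play 94 49 done (win 37 58 ∷ win 95 50 ∷ []))
  (force 94 51 (win 37 58) ∷ []) ∷ play 144 16 (play 94 49 done (win 37 58 ∷ win 95 50 ∷ []))
  (force 94 51 (win 37 58) ∷ []) ∷ []) ∷ play 96 52 (win 37 60) (force 94 53 (win 37 58) ∷ []) ∷
  play 96 52 (win 37 60) (force 94 53 (win 37 58) ∷ []) ∷ []) ∷ play 96 56 (win 37 60) (force 37
  58 (win 94 57) ∷ []) ∷ play 96 56 (win 37 60) (force 37 58 (win 94 57) ∷ []) ∷ [])) (play 3 37
  (play 103 42 (play 105 41 done (win 42 64 ∷ play 99 44 done (win 42 62 ∷ play 44 56 done (win 39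
  55 ∷ win 45 59 ∷ []) ∷ []) ∷ play 44 62 done (win 42 62 ∷ []) ∷ [])) (play 105 41 (win 42 64)
  (play 99 44 (win 42 62) (force 44 60 (win 39 55) ∷ []) ∷ force 39 55 (win 44 62) ∷ []) ∷ play
  101 43 (play 99 44 done (win 42 60 ∷ play 44 56 done (win 39 55 ∷ win 45 57 ∷ []) ∷ [])) (play
  99 44 (win 42 60) (force 44 58 (win 39 55) ∷ []) ∷ play 44 58 (win 39 55) (force 42 58 (win 99
  44) ∷ []) ∷ []) ∷ play 105 41 (play 44 60 done (win 39 55 ∷ win 45 61 ∷ [])) (force 39 55 (win
  44 62) ∷ play 44 60 (win 39 55) (force 42 58 (win 99 44) ∷ []) ∷ []) ∷ [])) (play 103 42 (play
  107 40 (win 42 66) (play 105 41 (win 42 64) (force 42 62 (win 44 62) ∷ []) ∷ force 44 64 (win 42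
  62) ∷ [])) (play 99 44 (play 101 43 (win 42 60) (force 42 58 (win 44 58) ∷ [])) (force 39 19
  (force 57 47 (win 44 56)) ∷ []) ∷ force 39 19 (play 107 40 (win 44 64) (play 105 41 (win 44 62)
  (force 57 49 (win 44 60) ∷ []) ∷ force 57 51 (win 44 60) ∷ [])) ∷ []) ∷ []) ∷ [])

after012324 : Tree
after012324 =
  play 115 29 (play 103 23 done (play 99 17 done (play 37 63 done (win 39 65 ∷ []) ∷ play 39 57
  done (play 94 19 done (win 37 58 ∷ win 112 31 ∷ []) ∷ play 94 19 done (win 37 58 ∷ win 112 31 ∷
  []) ∷ play 57 44 done (play 97 16 done (win 40 58 ∷ win 112 31 ∷ []) ∷ play 97 16 done (win 40
  58 ∷ win 112 31 ∷ []) ∷ win 100 25 ∷ []) ∷ []) ∷ play 39 56 done (play 44 60 done (win 37 57 ∷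
  []) ∷ play 44 60 done (win 37 57 ∷ []) ∷ play 40 57 done (play 96 17 done (win 44 56 ∷ win 112
  31 ∷ []) ∷ play 96 17 done (win 44 56 ∷ win 112 31 ∷ []) ∷ []) ∷ []) ∷ []) ∷ play 39 58 done
  (play 95 17 done (win 37 59 ∷ play 44 55 done (win 37 57 ∷ win 98 27 ∷ []) ∷ play 44 55 done
  (win 37 57 ∷ win 98 27 ∷ []) ∷ []) ∷ play 98 27 done (play 44 56 done (win 40 59 ∷ win 94 22 ∷
  []) ∷ play 44 55 done (win 37 57 ∷ win 94 22 ∷ []) ∷ []) ∷ play 44 58 done (play 100 14 done
  (win 40 61 ∷ play 98 15 done (win 40 59 ∷ win 112 31 ∷ []) ∷ play 98 15 done (win 40 59 ∷ win
  112 31 ∷ []) ∷ []) ∷ play 100 17 done (play 98 15 done (win 40 59 ∷ win 112 31 ∷ []) ∷ win 94 22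
  ∷ []) ∷ win 94 31 ∷ []) ∷ []) ∷ play 40 58 done (play 99 17 done (play 41 59 done (win 44 60 ∷
  []) ∷ play 41 59 done (win 44 60 ∷ []) ∷ play 94 19 done (win 37 58 ∷ win 112 31 ∷ []) ∷ []) ∷
  play 96 20 done (play 44 60 done (win 37 57 ∷ []) ∷ play 94 19 done (win 37 58 ∷ win 112 31 ∷
  []) ∷ []) ∷ play 39 56 done (play 96 20 done (win 44 60 ∷ win 97 28 ∷ []) ∷ play 96 29 done (win
  94 22 ∷ []) ∷ []) ∷ []) ∷ [])) (play 102 24 (play 99 17 done (win 37 66 ∷ play 57 44 done (play
  95 18 done (win 37 59 ∷ play 37 57 done (win 39 57 ∷ []) ∷ win 112 31 ∷ []) ∷ play 112 31 done
  (play 39 56 done (win 37 57 ∷ win 94 19 ∷ []) ∷ []) ∷ play 39 56 done (play 96 17 done (win 40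
  57 ∷ win 112 31 ∷ []) ∷ play 112 31 done (win 94 19 ∷ []) ∷ []) ∷ win 100 25 ∷ []) ∷ play 40 56
  done (play 41 57 done (play 97 16 done (win 44 56 ∷ win 112 31 ∷ []) ∷ play 97 16 done (win 44
  56 ∷ win 112 31 ∷ []) ∷ []) ∷ play 44 56 done (win 37 57 ∷ win 45 58 ∷ []) ∷ play 39 55 done
  (play 95 18 done (win 44 56 ∷ win 112 31 ∷ []) ∷ win 44 59 ∷ []) ∷ []) ∷ [])) (play 39 57 (play
  94 22 done (win 37 58 ∷ win 95 30 ∷ [])) (play 117 28 (play 94 22 done (win 37 58 ∷ win 95 23 ∷
  [])) (force 94 24 (win 37 58) ∷ []) ∷ play 99 18 (play 94 19 done (win 40 60 ∷ win 112 31 ∷ []))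
  (play 118 27 (play 44 57 done (win 40 60 ∷ win 100 19 ∷ [])) (force 100 19 (win 40 61) ∷ []) ∷
  play 97 19 (play 40 58 done (win 44 56 ∷ [])) (force 40 58 (win 44 56) ∷ []) ∷ []) ∷ []) ∷ play
  39 57 (play 94 22 done (win 37 58 ∷ win 95 30 ∷ [])) (play 117 28 (play 94 22 done (win 37 58 ∷
  win 95 23 ∷ [])) (force 94 24 (win 37 58) ∷ []) ∷ play 40 59 (play 97 19 done (win 44 59 ∷ win
  98 27 ∷ [])) (play 97 19 (win 44 59) (force 94 19 (win 112 31) ∷ []) ∷ []) ∷ []) ∷ []) ∷ play
  100 26 (play 95 21 done (win 37 64 ∷ play 37 57 done (play 44 53 done (win 39 57 ∷ win 96 29 ∷
  []) ∷ win 39 62 ∷ []) ∷ play 44 53 done (play 45 54 done (win 37 57 ∷ win 98 27 ∷ []) ∷ play 45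
  54 done (win 37 57 ∷ win 98 27 ∷ []) ∷ win 96 29 ∷ []) ∷ [])) (play 37 58 (play 44 58 done (win
  39 62 ∷ win 94 31 ∷ [])) (play 112 31 (play 44 58 done (win 39 62 ∷ win 94 22 ∷ [])) (force 94
  22 (win 39 62) ∷ []) ∷ []) ∷ play 96 21 (play 39 59 done (win 37 60 ∷ win 97 28 ∷ [])) (play 118
  27 (play 39 59 done (win 37 60 ∷ win 97 22 ∷ [])) (force 97 22 (win 37 61) ∷ []) ∷ play 94 22
  (play 37 58 done (win 39 58 ∷ [])) (force 37 58 (win 39 58) ∷ []) ∷ []) ∷ []) ∷ play 100 20
  (play 103 23 done (play 37 64 done (win 39 65 ∷ []) ∷ play 39 63 done (win 37 64 ∷ win 101 24 ∷
  []) ∷ [])) (play 121 24 (play 103 20 done (play 37 64 done (win 39 65 ∷ []) ∷ play 39 63 done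
  (win 37 64 ∷ win 101 21 ∷ []) ∷ [])) (play 103 20 (win 37 67) (force 101 21 (win 37 65) ∷ []) ∷
  play 103 20 (win 37 67) (force 101 21 (win 37 65) ∷ []) ∷ []) ∷ play 117 28 (play 37 58 done
  (play 94 22 done (win 39 62 ∷ win 101 24 ∷ []) ∷ play 94 22 done (win 39 62 ∷ win 101 24 ∷ []) ∷
  [])) (play 94 24 (play 37 58 done (win 39 62 ∷ [])) (force 37 58 (win 39 62) ∷ []) ∷ []) ∷ play
  96 21 (play 98 20 done (win 37 62 ∷ play 37 60 done (win 39 60 ∷ []) ∷ [])) (play 118 27 (play
  39 59 done (win 37 60 ∷ win 97 22 ∷ [])) (force 97 22 (win 37 61) ∷ []) ∷ play 94 22 (play 37 58
  done (win 39 58 ∷ [])) (force 37 58 (win 39 58) ∷ []) ∷ []) ∷ []) ∷ [])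

after01232 : Tree
after01232 =
  play 124 22 after012324 (play 40 58 (play 128 20 (play 96 31 done (win 37 60 ∷ play 126 21 done
  (play 94 31 done (win 37 58 ∷ win 99 30 ∷ []) ∷ win 97 32 ∷ []) ∷ play 126 21 done (play 94 31
  done (win 37 58 ∷ win 99 30 ∷ []) ∷ win 97 32 ∷ []) ∷ [])) (play 99 30 (play 102 28 done (play
  44 57 done (win 41 59 ∷ win 94 31 ∷ []) ∷ play 41 59 done (win 44 59 ∷ []) ∷ [])) (play 126 21
  (play 94 31 done (win 37 58 ∷ win 95 32 ∷ [])) (force 94 33 (win 37 58) ∷ []) ∷ play 126 21
  (play 94 31 done (win 37 58 ∷ win 95 32 ∷ [])) (force 94 33 (win 37 58) ∷ []) ∷ []) ∷ play 96 34
  (win 37 60) (force 94 35 (win 37 58) ∷ []) ∷ play 96 34 (win 37 60) (force 94 35 (win 37 58) ∷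
  []) ∷ [])) (play 112 31 (play 102 24 (play 105 22 done (play 44 60 done (win 41 62 ∷ win 94 19 ∷
  []) ∷ play 41 62 done (win 44 62 ∷ []) ∷ [])) (play 99 26 (play 44 57 done (win 41 59 ∷ win 94
  19 ∷ [])) (play 39 56 (win 94 19) (force 96 17 (win 44 56) ∷ []) ∷ []) ∷ play 114 30 (play 39 56
  done (play 94 19 done (win 96 19 ∷ []) ∷ play 96 17 done (win 44 59 ∷ win 97 18 ∷ []) ∷ []))
  (play 39 56 (win 94 21) (force 96 19 (win 44 59) ∷ []) ∷ []) ∷ [])) (play 101 25 (play 114 30
  (play 94 19 done (win 41 61 ∷ win 95 20 ∷ [])) (force 94 21 (win 41 61) ∷ [])) (force 94 19
  (force 99 26 (win 41 59)) ∷ []) ∷ play 101 25 (play 114 30 (play 94 19 done (win 41 61 ∷ win 95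
  20 ∷ [])) (force 94 21 (win 41 61) ∷ [])) (force 94 19 (force 99 26 (win 41 59)) ∷ []) ∷ []) ∷
  []) ∷ play 40 57 (play 102 25 (play 112 31 done (play 98 27 done (win 41 62 ∷ play 44 55 done
  (win 37 57 ∷ win 45 58 ∷ []) ∷ []) ∷ play 44 60 done (win 41 62 ∷ win 94 31 ∷ []) ∷ play 41 62
  done (win 94 31 ∷ []) ∷ [])) (play 100 26 (play 98 27 done (win 41 60 ∷ play 44 55 done (win 37
  57 ∷ win 45 56 ∷ []) ∷ [])) (play 98 27 (win 41 60) (force 37 57 (win 44 57) ∷ []) ∷ play 44 57
  (win 37 57) (force 41 58 (win 98 27) ∷ []) ∷ []) ∷ play 95 30 (win 37 59) (force 37 57 (win 44
  59) ∷ []) ∷ play 95 30 (win 37 59) (force 37 57 (win 44 59) ∷ []) ∷ [])) (play 104 24 (play 112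
  31 (play 44 62 done (win 41 64 ∷ win 94 31 ∷ [])) (play 106 23 (win 41 66) (force 41 64 (win 44
  63) ∷ []) ∷ force 41 64 (win 94 31) ∷ [])) (play 100 26 (play 102 25 (win 41 62) (force 44 59
  (win 41 60) ∷ [])) (force 44 57 (force 41 58 (win 98 27)) ∷ []) ∷ play 112 31 (play 39 56 (win
  94 31) (force 44 61 (win 96 29) ∷ [])) (force 98 27 (force 41 58 (win 44 61)) ∷ []) ∷ []) ∷ [])
  ∷ play 100 28 (play 104 26 (win 37 68) (force 39 66 (win 37 64) ∷ play 102 27 (win 37 66) (force
  39 64 (win 37 64) ∷ []) ∷ [])) (force 37 59 (play 126 21 (play 94 31 done (win 39 62 ∷ win 95 32
  ∷ [])) (play 102 27 (win 39 64) (force 39 62 (win 94 31) ∷ []) ∷ force 39 62 (win 94 33) ∷ []))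
  ∷ play 96 30 (play 98 29 (win 37 62) (force 39 60 (win 37 60) ∷ [])) (force 39 58 (force 37 58
  (win 94 31)) ∷ []) ∷ []) ∷ [])

after01230 : Tree
after01230 =
  play 155 7 (play 151 10 (play 96 48 done (play 100 56 done (play 37 60 done (win 39 62 ∷ []) ∷
  play 98 47 done (win 37 62 ∷ play 37 60 done (win 39 60 ∷ []) ∷ []) ∷ []) ∷ play 99 54 done
  (play 37 60 done (win 39 61 ∷ []) ∷ play 39 59 done (win 37 60 ∷ win 97 55 ∷ []) ∷ []) ∷ play 37
  58 done (play 94 49 done (win 39 58 ∷ win 97 59 ∷ []) ∷ play 94 49 done (win 39 58 ∷ win 97 59 ∷
  []) ∷ []) ∷ play 39 59 done (play 94 49 done (win 37 58 ∷ win 99 57 ∷ []) ∷ play 99 57 done (win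
  97 55 ∷ []) ∷ win 97 59 ∷ []) ∷ [])) (play 39 57 (play 94 58 done (win 37 58 ∷ win 95 61 ∷ []))
  (play 97 59 (play 94 49 done (win 40 58 ∷ win 95 57 ∷ [])) (force 94 58 (win 37 58) ∷ []) ∷ play
  99 54 (play 94 49 done (win 40 60 ∷ win 100 56 ∷ [])) (play 101 53 (win 40 62) (force 94 49 (win
  40 60) ∷ []) ∷ play 94 49 (win 100 56) (force 97 55 (win 40 58) ∷ []) ∷ []) ∷ []) ∷ play 100 47
  (play 104 52 done (play 37 64 done (win 39 66 ∷ []) ∷ play 102 46 done (win 37 66 ∷ play 37 64
  done (win 39 64 ∷ []) ∷ []) ∷ [])) (play 148 12 (play 103 47 done (play 37 64 done (win 39 65 ∷
  []) ∷ play 39 63 done (win 37 64 ∷ win 101 48 ∷ []) ∷ [])) (play 103 47 (win 37 67) (force 101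
  48 (win 37 65) ∷ []) ∷ play 103 47 (win 37 67) (force 101 48 (win 37 65) ∷ []) ∷ []) ∷ play 144
  16 (play 37 59 done (play 102 46 done (win 39 64 ∷ play 94 49 done (win 39 62 ∷ []) ∷ []) ∷ play
  94 49 done (win 39 62 ∷ win 95 50 ∷ []) ∷ [])) (play 94 51 (play 37 58 done (win 39 62 ∷ []))
  (force 37 58 (win 39 62) ∷ []) ∷ []) ∷ play 96 48 (play 98 47 done (win 37 62 ∷ play 37 60 done
  (win 39 60 ∷ []) ∷ [])) (play 145 15 (play 39 59 done (win 37 60 ∷ win 97 49 ∷ [])) (force 97 49
  (win 37 61) ∷ []) ∷ play 94 49 (play 37 58 done (win 39 58 ∷ [])) (force 37 58 (win 39 58) ∷ [])
  ∷ []) ∷ []) ∷ play 40 57 (play 94 58 done (win 37 58 ∷ win 95 61 ∷ [])) (play 41 58 (play 98 58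
  done (win 94 58 ∷ [])) (force 98 58 (win 94 58) ∷ []) ∷ play 39 56 (win 94 62) (force 96 60 (win
  94 58) ∷ []) ∷ []) ∷ [])) (play 39 59 (play 96 61 (win 37 60) (force 37 58 (win 94 62) ∷ []))
  (play 101 56 (play 103 55 (win 40 64) (force 94 49 (win 40 62) ∷ [])) (force 40 60 (force 99 57
  (win 94 49)) ∷ []) ∷ []) ∷ play 100 46 (play 104 44 (win 37 68) (force 39 66 (win 37 64) ∷ play
  102 45 (win 37 66) (force 39 64 (win 37 64) ∷ []) ∷ [])) (force 37 59 (play 144 16 (play 94 49
  done (win 39 62 ∷ win 95 50 ∷ [])) (play 102 45 (win 39 64) (force 39 62 (win 94 49) ∷ []) ∷
  force 39 62 (win 94 51) ∷ [])) ∷ play 96 48 (play 98 47 (win 37 62) (force 39 60 (win 37 60) ∷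
  [])) (force 39 58 (force 37 58 (win 94 49)) ∷ []) ∷ []) ∷ play 96 61 (play 98 60 (win 37 62)
  (force 37 60 (win 39 60) ∷ [])) (force 94 62 (force 37 58 (win 39 58)) ∷ []) ∷ [])

after0122334 : Tree
after0122334 =
  play 124 8 (play 103 23 done (play 95 17 done (win 39 57 ∷ play 82 20 done (win 39 55 ∷ win 101
  24 ∷ []) ∷ play 44 52 done (win 39 55 ∷ []) ∷ []) ∷ play 101 24 done (play 95 17 done (win 39 57
  ∷ play 39 55 done (win 44 52 ∷ []) ∷ []) ∷ play 82 22 done (win 39 55 ∷ []) ∷ []) ∷ play 105 22
  done (play 95 17 done (win 39 57 ∷ play 82 22 done (win 39 55 ∷ []) ∷ []) ∷ play 82 24 done (win
  39 55 ∷ []) ∷ []) ∷ [])) (play 103 23 (play 101 24 done (play 82 20 done (win 39 55 ∷ win 83 21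
  ∷ []) ∷ play 82 20 done (win 39 55 ∷ win 83 21 ∷ []) ∷ [])) (play 101 24 (play 44 51 done (win
  39 55 ∷ win 82 22 ∷ [])) (force 82 22 (win 39 55) ∷ []) ∷ play 95 30 (win 39 57) (force 82 22
  (win 39 55) ∷ []) ∷ []) ∷ play 114 12 (play 112 13 done (play 101 22 done (play 94 19 done (win
  39 56 ∷ win 95 20 ∷ []) ∷ play 94 19 done (win 39 56 ∷ win 95 20 ∷ []) ∷ []) ∷ play 101 22 done
  (play 94 19 done (win 39 56 ∷ win 95 20 ∷ []) ∷ play 94 19 done (win 39 56 ∷ win 95 20 ∷ []) ∷
  []) ∷ play 101 22 done (play 94 19 done (win 39 56 ∷ win 95 20 ∷ []) ∷ play 94 19 done (win 39
  56 ∷ win 95 20 ∷ []) ∷ []) ∷ [])) (play 112 13 (play 101 22 done (play 82 20 done (win 39 55 ∷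
  win 94 21 ∷ []) ∷ play 82 20 done (win 39 55 ∷ win 94 21 ∷ []) ∷ [])) (play 101 22 (play 44 51
  done (win 39 55 ∷ win 94 21 ∷ [])) (force 94 21 (win 39 56) ∷ []) ∷ play 96 20 (win 39 58)
  (force 94 21 (win 39 56) ∷ []) ∷ []) ∷ play 112 13 (play 96 20 done (play 44 51 done (win 39 55
  ∷ win 94 21 ∷ []) ∷ play 39 55 done (win 44 53 ∷ []) ∷ [])) (play 101 22 (play 44 51 done (win
  39 55 ∷ win 94 21 ∷ [])) (force 94 21 (win 39 56) ∷ []) ∷ play 96 20 (win 39 58) (force 94 21
  (win 39 56) ∷ []) ∷ []) ∷ play 112 13 (play 95 18 done (play 96 19 done (win 101 22 ∷ []) ∷ play
  96 19 done (win 101 22 ∷ []) ∷ play 39 55 done (win 44 52 ∷ []) ∷ [])) (play 96 20 (win 39 58)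
  (force 94 21 (win 39 56) ∷ []) ∷ play 96 20 (win 39 58) (force 94 21 (win 39 56) ∷ []) ∷ []) ∷
  []) ∷ play 97 29 (win 39 59) (play 95 30 (win 39 57) (force 39 55 (win 44 52) ∷ []) ∷ force 44
  54 (win 39 55) ∷ []) ∷ play 103 23 (play 105 22 done (play 96 16 done (play 44 51 done (win 39
  55 ∷ win 82 22 ∷ []) ∷ play 39 55 done (win 44 53 ∷ []) ∷ []) ∷ play 44 51 done (win 39 55 ∷ win
  82 24 ∷ []) ∷ [])) (play 101 24 (play 96 16 done (play 44 51 done (win 39 55 ∷ win 82 20 ∷ []) ∷
  play 39 55 done (win 44 53 ∷ []) ∷ [])) (play 95 17 (win 39 57) (force 82 20 (win 39 55) ∷ []) ∷
  []) ∷ play 101 24 (play 44 51 done (win 39 55 ∷ win 82 22 ∷ [])) (play 95 17 (win 39 57) (force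
  39 55 (win 44 52) ∷ []) ∷ []) ∷ []) ∷ [])

after0122324 : Tree
after0122324 =
  play 119 7 (play 115 9 done (play 98 23 done (play 44 53 done (win 37 45 ∷ win 96 24 ∷ []) ∷
  play 44 55 done (win 37 45 ∷ []) ∷ []) ∷ play 112 11 done (play 98 16 done (win 40 59 ∷ play 96
  17 done (win 40 57 ∷ win 101 19 ∷ []) ∷ play 44 55 done (win 37 45 ∷ []) ∷ []) ∷ play 98 16 done
  (win 40 59 ∷ play 96 17 done (win 40 57 ∷ win 101 19 ∷ []) ∷ play 44 55 done (win 37 45 ∷ []) ∷
  []) ∷ play 98 16 done (win 40 59 ∷ play 96 17 done (win 40 57 ∷ win 101 19 ∷ []) ∷ play 101 15
  done (win 94 19 ∷ win 102 18 ∷ []) ∷ []) ∷ []) ∷ play 98 23 done (play 44 53 done (win 37 45 ∷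
  win 96 24 ∷ []) ∷ win 94 26 ∷ []) ∷ play 98 20 done (win 40 59 ∷ play 117 8 done (play 96 20
  done (win 40 57 ∷ win 101 19 ∷ []) ∷ win 99 21 ∷ []) ∷ play 117 8 done (win 99 21 ∷ play 96 20
  done (win 40 57 ∷ win 101 19 ∷ []) ∷ []) ∷ []) ∷ [])) (play 98 23 (win 40 59) (play 96 24 (win
  40 57) (force 37 45 (win 44 53) ∷ []) ∷ force 37 45 (win 44 55) ∷ []) ∷ play 114 10 (play 112 11
  done (play 98 17 done (play 96 17 done (win 40 57 ∷ win 101 19 ∷ []) ∷ play 44 55 done (win 37
  45 ∷ []) ∷ []) ∷ play 98 18 done (play 96 17 done (win 40 57 ∷ win 101 19 ∷ []) ∷ win 94 21 ∷
  []) ∷ play 98 18 done (play 96 17 done (win 40 57 ∷ win 101 19 ∷ []) ∷ win 94 21 ∷ []) ∷ []))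
  (play 112 11 (play 94 19 done (play 96 19 done (win 101 19 ∷ []) ∷ play 96 19 done (win 101 19 ∷
  []) ∷ [])) (play 94 19 (play 96 19 done (win 101 19 ∷ [])) (force 96 19 (win 101 19) ∷ []) ∷
  play 94 19 (play 96 19 done (win 101 19 ∷ [])) (force 96 19 (win 101 19) ∷ []) ∷ []) ∷ play 112
  11 (play 98 18 done (play 44 53 done (win 37 45 ∷ win 96 19 ∷ []) ∷ win 94 21 ∷ [])) (play 98 18
  (win 40 59) (force 96 19 (win 40 57) ∷ []) ∷ play 98 18 (win 94 21) (force 96 19 (win 40 57) ∷
  []) ∷ []) ∷ play 112 11 (play 96 17 done (play 97 18 done (win 101 19 ∷ []) ∷ play 97 18 done
  (win 101 19 ∷ []) ∷ play 44 53 done (win 37 45 ∷ []) ∷ [])) (play 98 18 (win 40 59) (force 96 19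
  (win 40 57) ∷ []) ∷ play 98 18 (win 94 21) (force 96 19 (win 40 57) ∷ []) ∷ []) ∷ []) ∷ play 98
  23 (win 40 59) (play 96 24 (win 40 57) (force 37 45 (win 44 53) ∷ []) ∷ force 37 45 (win 44 55)
  ∷ []) ∷ play 115 9 (play 98 18 done (play 96 17 done (win 40 57 ∷ play 112 11 done (win 101 19 ∷
  []) ∷ play 37 45 done (win 44 53 ∷ []) ∷ []) ∷ play 96 17 done (win 40 57 ∷ play 112 11 done
  (win 101 19 ∷ []) ∷ play 37 45 done (win 44 53 ∷ []) ∷ []) ∷ play 37 45 done (win 44 55 ∷ []) ∷
  [])) (play 98 23 (win 40 59) (force 40 57 (win 96 24) ∷ []) ∷ play 98 16 (win 40 59) (play 96 17
  (win 40 57) (force 112 11 (win 101 19) ∷ force 37 45 (win 44 53) ∷ []) ∷ play 96 17 (win 40 57)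
  (force 112 11 (win 101 19) ∷ force 37 45 (win 44 53) ∷ []) ∷ force 37 45 (win 44 55) ∷ []) ∷
  play 98 23 (win 40 59) (force 40 57 (win 96 24) ∷ []) ∷ []) ∷ [])

after01223 : Tree
after01223 =
  play 122 9 (play 39 56 (play 125 7 done (play 98 29 done (play 44 53 done (win 37 45 ∷ win 96 30
  ∷ []) ∷ play 37 45 done (win 44 55 ∷ []) ∷ []) ∷ play 103 24 done (play 101 25 done (play 82 20
  done (win 37 46 ∷ win 96 27 ∷ []) ∷ play 82 20 done (win 37 46 ∷ win 96 27 ∷ []) ∷ []) ∷ play
  101 25 done (play 44 53 done (win 37 45 ∷ win 96 27 ∷ []) ∷ win 94 29 ∷ []) ∷ play 105 23 done
  (play 82 22 done (win 37 46 ∷ win 96 27 ∷ []) ∷ win 94 29 ∷ []) ∷ []) ∷ play 115 12 done (play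
  98 26 done (play 44 53 done (win 37 45 ∷ win 96 27 ∷ []) ∷ play 44 55 done (win 37 45 ∷ []) ∷
  []) ∷ play 112 14 done (play 98 16 done (win 40 59 ∷ play 96 17 done (win 40 57 ∷ win 101 22 ∷
  []) ∷ play 44 55 done (win 37 45 ∷ []) ∷ []) ∷ play 98 16 done (play 96 17 done (win 40 57 ∷ win
  101 22 ∷ []) ∷ win 40 59 ∷ play 44 55 done (win 37 45 ∷ []) ∷ []) ∷ play 98 16 done (play 96 17
  done (win 40 57 ∷ win 101 22 ∷ []) ∷ win 40 59 ∷ play 101 15 done (win 102 21 ∷ win 94 19 ∷ [])
  ∷ []) ∷ []) ∷ play 98 26 done (play 44 53 done (win 37 45 ∷ win 96 27 ∷ []) ∷ win 94 29 ∷ []) ∷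
  play 98 20 done (play 117 11 done (play 96 20 done (win 40 57 ∷ win 101 22 ∷ []) ∷ win 99 24 ∷
  []) ∷ win 40 59 ∷ play 117 11 done (win 99 24 ∷ play 96 20 done (win 101 22 ∷ win 40 57 ∷ []) ∷
  []) ∷ []) ∷ []) ∷ play 98 29 done (play 44 53 done (win 37 45 ∷ win 96 30 ∷ []) ∷ win 94 32 ∷
  []) ∷ play 127 6 done (play 96 32 done (win 94 32 ∷ []) ∷ play 96 27 done (play 101 27 done (win
  97 29 ∷ []) ∷ play 101 27 done (win 97 29 ∷ []) ∷ play 37 45 done (win 44 53 ∷ []) ∷ []) ∷ play
  98 25 done (play 96 17 done (win 40 57 ∷ play 112 16 done (win 101 25 ∷ []) ∷ play 37 45 done
  (win 44 53 ∷ []) ∷ []) ∷ play 96 17 done (play 112 16 done (win 101 25 ∷ []) ∷ win 40 57 ∷ play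
  37 45 done (win 44 53 ∷ []) ∷ []) ∷ play 37 45 done (win 44 55 ∷ []) ∷ []) ∷ win 94 34 ∷ []) ∷
  [])) (play 98 26 (win 40 59) (play 96 27 (win 40 57) (force 44 53 (win 37 45) ∷ []) ∷ force 37
  45 (win 44 55) ∷ []) ∷ [])) (force 37 47 after0122334 ∷ force 39 56 after0122324 ∷ force 39 55
  (play 97 27 (win 40 58) (play 95 28 (win 40 56) (force 44 52 (win 37 45) ∷ []) ∷ force 37 45
  (win 44 54) ∷ [])) ∷ force 39 56 (play 126 7 (play 128 6 done (play 96 33 done (win 94 33 ∷ [])
  ∷ play 101 28 done (play 96 27 done (win 40 57 ∷ win 97 30 ∷ []) ∷ win 94 33 ∷ []) ∷ play 98 27
  done (win 40 59 ∷ play 124 8 done (play 96 27 done (win 40 57 ∷ win 101 26 ∷ []) ∷ win 99 28 ∷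
  []) ∷ play 124 8 done (win 99 28 ∷ play 96 27 done (win 40 57 ∷ win 101 26 ∷ []) ∷ []) ∷ []) ∷
  win 94 35 ∷ [])) (play 98 30 (win 40 59) (force 40 57 (win 96 31) ∷ []) ∷ play 129 5 (play 98 26
  done (win 40 59 ∷ play 96 27 done (win 40 57 ∷ win 101 29 ∷ []) ∷ play 96 27 done (win 40 57 ∷
  win 101 29 ∷ []) ∷ [])) (play 101 26 (play 94 29 done (win 102 28 ∷ [])) (play 98 26 (win 40 59)
  (force 96 27 (win 40 57) ∷ []) ∷ force 94 29 (win 102 28) ∷ []) ∷ play 112 18 (play 96 17 done
  (play 97 26 done (win 101 26 ∷ []) ∷ play 97 26 done (win 101 26 ∷ []) ∷ play 44 53 done (win 37
  45 ∷ []) ∷ [])) (play 98 26 (win 40 59) (force 96 27 (win 40 57) ∷ []) ∷ play 98 26 (win 94 29)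
  (force 96 27 (win 40 57) ∷ []) ∷ []) ∷ play 102 26 (play 96 28 done (win 103 27 ∷ win 94 29 ∷
  [])) (force 40 57 (play 98 26 done (win 103 27 ∷ win 96 27 ∷ [])) ∷ play 101 26 (win 94 29)
  (force 96 27 (win 40 57) ∷ []) ∷ []) ∷ []) ∷ play 115 13 (play 98 18 done (play 96 17 done (win
  40 57 ∷ play 112 15 done (win 101 22 ∷ []) ∷ play 37 45 done (win 44 53 ∷ []) ∷ []) ∷ play 96 17
  done (win 40 57 ∷ play 112 15 done (win 101 22 ∷ []) ∷ play 37 45 done (win 44 53 ∷ []) ∷ []) ∷
  play 37 45 done (win 44 55 ∷ []) ∷ [])) (play 98 26 (win 40 59) (force 40 57 (win 96 27) ∷ []) ∷
  play 98 16 (win 40 59) (play 96 17 (win 40 57) (force 112 15 (win 101 22) ∷ force 37 45 (win 44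
  53) ∷ []) ∷ play 96 17 (win 40 57) (force 112 15 (win 101 22) ∷ force 37 45 (win 44 53) ∷ []) ∷
  force 37 45 (win 44 55) ∷ []) ∷ play 98 26 (win 40 59) (force 40 57 (win 96 27) ∷ []) ∷ []) ∷
  play 98 30 (win 40 59) (force 40 57 (win 96 31) ∷ []) ∷ [])) ∷ [])

after0122 : Tree
after0122 =
  play 81 19 after01223 (play 64 22 (play 39 30 (play 67 28 (win 37 31) (force 65 29 (win 37 29) ∷
  [])) (play 72 23 (play 74 22 (win 40 35) (force 40 33 (win 44 31) ∷ [])) (force 70 24 (force 40
  31 (win 44 29)) ∷ []) ∷ [])) (play 45 24 (force 24 23 (play 89 13 (play 66 22 done (win 39 28 ∷
  play 87 14 done (play 48 23 done (win 39 26 ∷ win 70 20 ∷ []) ∷ win 67 23 ∷ []) ∷ play 87 14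
  done (win 67 23 ∷ play 48 23 done (win 39 26 ∷ win 70 20 ∷ []) ∷ []) ∷ [])) (play 67 24 (win 39
  29) (force 39 27 (win 65 25) ∷ []) ∷ play 72 19 (play 70 20 done (play 48 23 done (win 39 26 ∷
  win 49 24 ∷ []) ∷ win 46 27 ∷ [])) (play 48 25 (win 39 26) (force 46 25 (win 70 20) ∷ []) ∷ play
  70 20 (win 46 27) (force 39 26 (win 48 25) ∷ []) ∷ []) ∷ play 67 24 (win 39 29) (force 39 27
  (win 65 25) ∷ []) ∷ []))) (play 89 13 (play 87 14 (play 37 21 (play 44 22 done (play 67 21 done
  (win 68 22 ∷ win 57 25 ∷ []) ∷ play 67 23 done (win 65 23 ∷ []) ∷ [])) (play 44 22 (win 65 25)
  (force 57 25 (win 67 23) ∷ []) ∷ play 44 22 (win 65 25) (force 57 25 (win 67 23) ∷ []) ∷ []))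
  (play 47 26 (play 46 25 (win 70 20) (force 70 18 (win 72 18) ∷ [])) (force 70 18 (force 74 16
  (win 48 27)) ∷ []) ∷ [])) (force 24 23 (play 72 19 (play 74 18 (win 46 29) (force 48 27 (win 46
  27) ∷ [])) (force 48 25 (force 46 25 (win 70 20)) ∷ [])) ∷ []) ∷ []) ∷ force 84 17 (play 40 21
  (play 46 20 (play 57 25 done (win 37 21 ∷ win 58 27 ∷ [])) (play 59 24 (win 37 23) (force 57 25
  (win 37 21) ∷ []) ∷ play 24 21 (play 57 25 done (win 58 27 ∷ win 44 21 ∷ [])) (force 44 21 (win
  57 28) ∷ []) ∷ [])) (play 62 23 (play 41 22 (play 57 25 done (win 44 21 ∷ [])) (force 44 21 (win
  57 25) ∷ [])) (force 41 22 (force 57 25 (win 44 21)) ∷ []) ∷ play 44 21 (play 39 19 (win 57 28)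
  (force 59 26 (win 57 25) ∷ [])) (force 57 25 (force 66 28 (win 45 22)) ∷ []) ∷ [])) ∷ []) ∷ play
  70 17 (play 41 34 (play 73 22 (win 37 37) (force 71 23 (win 37 35) ∷ [])) (play 3 37 (play 83 18
  (play 44 38 done (win 39 32 ∷ win 45 39 ∷ [])) (force 39 32 (win 44 40) ∷ play 44 38 (win 39 32)
  (force 42 35 (win 76 18) ∷ []) ∷ [])) (force 39 19 (play 85 17 (win 44 42) (play 83 18 (win 44
  40) (force 57 27 (win 44 38) ∷ []) ∷ force 57 29 (win 44 38) ∷ [])) ∷ []) ∷ [])) (force 46 37
  (play 0 25 (play 48 36 (win 24 25) (force 24 23 (win 39 32) ∷ [])) (force 24 21 (force 44 38
  (win 39 32)) ∷ play 1 26 (play 48 36 (win 26 23) (force 26 21 (win 39 32) ∷ [])) (force 26 19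
  (force 44 38 (win 39 32)) ∷ []) ∷ [])) ∷ play 63 11 (play 66 17 (play 68 16 (win 37 32) (force
  39 30 (win 37 30) ∷ [])) (force 39 28 (force 37 28 (win 64 18)) ∷ [])) (force 3 37 (play 66 17
  (play 68 16 (win 39 30) (force 41 28 (win 39 28) ∷ [])) (force 41 26 (force 39 26 (win 64 18)) ∷
  [])) ∷ force 77 18 (play 45 22 (play 59 13 (play 61 12 done (win 37 25 ∷ play 37 23 done (win 39
  23 ∷ []) ∷ [])) (play 61 12 (win 37 25) (force 37 23 (win 39 23) ∷ []) ∷ play 57 14 (play 37 21
  done (win 39 21 ∷ [])) (force 37 21 (win 39 21) ∷ []) ∷ [])) (play 59 13 (play 68 10 (play 39 22
  done (win 37 23 ∷ win 46 23 ∷ [])) (force 46 23 (win 37 23) ∷ [])) (force 57 14 (force 37 21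
  (win 39 21)) ∷ []) ∷ play 44 21 (play 79 17 (win 64 16) (force 64 14 (win 66 14) ∷ [])) (force
  75 19 (force 64 12 (win 66 12)) ∷ []) ∷ [])) ∷ []) ∷ []) ∷ [])

after01123 : Tree
after01123 =
  play 109 8 (play 24 22 (play 48 21 done (play 37 28 done (play 66 44 done (win 64 42 ∷ []) ∷
  play 47 20 done (play 68 42 done (win 66 40 ∷ []) ∷ win 66 44 ∷ []) ∷ []) ∷ play 70 40 done
  (play 49 22 done (win 37 27 ∷ win 64 42 ∷ []) ∷ play 49 22 done (win 64 42 ∷ win 37 27 ∷ []) ∷
  []) ∷ play 65 34 done (play 49 22 done (win 37 27 ∷ win 70 40 ∷ []) ∷ win 37 29 ∷ play 37 27
  done (win 44 22 ∷ []) ∷ []) ∷ play 44 21 done (play 66 44 done (win 64 42 ∷ []) ∷ play 66 40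
  done (win 67 43 ∷ win 45 22 ∷ []) ∷ []) ∷ [])) (play 68 39 (play 44 26 done (win 37 32 ∷ win 69
  41 ∷ [])) (play 45 22 (play 47 22 done (win 37 27 ∷ win 64 42 ∷ [])) (play 70 38 (play 47 22
  done (win 37 27 ∷ win 48 23 ∷ [])) (force 47 24 (win 37 27) ∷ []) ∷ play 44 21 (win 64 42)
  (force 47 22 (win 66 40) ∷ []) ∷ []) ∷ play 37 28 (play 47 23 done (win 64 42 ∷ win 44 25 ∷ []))
  (force 44 26 (win 69 41) ∷ []) ∷ []) ∷ play 66 41 (play 44 24 done (win 37 30 ∷ win 67 43 ∷ []))
  (play 68 40 (win 37 32) (force 37 30 (win 44 25) ∷ []) ∷ play 64 42 (play 37 28 done (win 44 23
  ∷ [])) (force 37 28 (win 44 23) ∷ []) ∷ []) ∷ play 50 18 (play 47 18 done (play 66 44 done (win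
  64 42 ∷ []) ∷ play 57 37 done (win 37 21 ∷ win 66 44 ∷ []) ∷ win 64 46 ∷ [])) (play 59 36 (play
  51 19 done (win 37 23 ∷ win 69 41 ∷ [])) (play 96 16 (play 44 17 done (win 37 23 ∷ win 60 37 ∷
  [])) (force 60 37 (win 37 24) ∷ []) ∷ play 57 37 (play 37 21 done (win 44 16 ∷ [])) (force 37 21
  (win 44 16) ∷ []) ∷ []) ∷ play 59 36 (play 51 19 done (win 37 23 ∷ win 69 41 ∷ [])) (play 96 16
  (play 51 19 done (win 37 23 ∷ win 69 37 ∷ [])) (force 60 37 (win 37 24) ∷ []) ∷ play 57 37 (play
  37 21 done (win 44 16 ∷ [])) (force 37 21 (win 44 16) ∷ []) ∷ []) ∷ play 25 24 (play 47 18 done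
  (play 66 44 done (win 64 42 ∷ []) ∷ play 57 37 done (win 66 44 ∷ win 44 14 ∷ []) ∷ [])) (play 47
  18 (win 64 46) (force 48 19 (win 66 44) ∷ []) ∷ play 47 18 (win 64 46) (force 48 19 (win 66 44)
  ∷ []) ∷ []) ∷ []) ∷ [])) (play 46 23 (play 99 13 (play 37 28 done (play 66 34 done (win 38 29 ∷
  win 67 39 ∷ []) ∷ play 64 36 done (win 66 40 ∷ []) ∷ [])) (play 48 25 (play 47 24 done (play 70
  30 done (win 72 34 ∷ []) ∷ win 70 36 ∷ [])) (play 70 30 (play 74 32 done (win 49 26 ∷ []))
  (force 74 32 (win 49 26) ∷ []) ∷ play 47 24 (win 70 36) (force 70 30 (win 72 34) ∷ []) ∷ []) ∷
  play 37 28 (win 64 42) (force 64 36 (win 66 40) ∷ []) ∷ [])) (play 107 9 (play 48 25 (play 47 24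
  done (play 70 36 done (win 72 36 ∷ []) ∷ win 70 38 ∷ [])) (play 70 36 (play 74 34 done (win 49
  26 ∷ [])) (force 74 34 (win 49 26) ∷ []) ∷ play 47 24 (win 70 38) (force 70 36 (win 72 36) ∷ [])
  ∷ [])) (play 48 25 (play 47 24 (win 70 38) (force 70 36 (win 72 36) ∷ [])) (force 70 36 (force
  74 34 (win 49 26)) ∷ []) ∷ []) ∷ play 99 13 (play 44 21 (win 64 42) (play 45 22 (win 66 40)
  (force 66 34 (win 68 38) ∷ []) ∷ force 64 36 (win 66 40) ∷ [])) (play 48 25 (play 47 24 (win 70
  36) (force 70 30 (win 72 34) ∷ [])) (force 70 30 (force 74 32 (win 49 26)) ∷ []) ∷ []) ∷ []) ∷
  play 70 37 (play 37 35 (win 71 39) (force 73 37 (win 38 36) ∷ [])) (play 38 29 (play 37 28 (win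
  64 42) (force 44 27 (win 66 40) ∷ [])) (force 68 38 (force 39 30 (win 44 27)) ∷ []) ∷ []) ∷ [])

after0102 : Tree
after0102 =
  play 0 7 (play 3 26 (play 1 24 (play 52 46 done (play 26 27 done (win 24 27 ∷ []) ∷ play 44 50
  done (play 26 19 done (win 27 24 ∷ win 4 33 ∷ []) ∷ win 24 27 ∷ []) ∷ win 24 29 ∷ [])) (play 52
  46 (play 26 25 done (win 4 33 ∷ win 27 26 ∷ [])) (play 26 25 (win 4 33) (force 24 21 (win 44 50)
  ∷ []) ∷ force 26 27 (win 4 33) ∷ []) ∷ play 4 27 (play 54 45 done (play 52 46 done (play 30 23
  done (win 26 25 ∷ []) ∷ win 26 27 ∷ []) ∷ play 30 25 done (win 26 25 ∷ []) ∷ win 26 29 ∷ []))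
  (play 46 49 (play 48 48 done (play 30 19 done (win 26 21 ∷ []) ∷ win 26 23 ∷ [])) (play 30 17
  (play 26 19 done (win 44 50 ∷ [])) (force 26 19 (win 44 50) ∷ []) ∷ play 48 48 (win 26 23)
  (force 26 21 (win 30 19) ∷ []) ∷ []) ∷ []) ∷ [])) (play 1 24 (play 46 49 (play 44 50 done (play
  26 19 done (win 4 33 ∷ win 27 20 ∷ []) ∷ win 24 23 ∷ [])) (play 26 21 (win 4 33) (force 24 21
  (win 44 50) ∷ []) ∷ play 48 48 (win 24 25) (force 24 23 (win 26 23) ∷ []) ∷ [])) (force 2 25
  (play 46 49 (play 48 48 done (play 28 21 done (win 26 21 ∷ []) ∷ win 26 23 ∷ [])) (play 28 19
  (play 26 19 done (win 44 50 ∷ [])) (force 26 19 (win 44 50) ∷ []) ∷ play 48 48 (win 26 23)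
  (force 26 21 (win 28 21) ∷ []) ∷ [])) ∷ []) ∷ play 5 28 (play 6 29 (play 54 45 done (play 52 46
  done (play 34 19 done (win 30 21 ∷ []) ∷ win 30 23 ∷ []) ∷ play 34 21 done (win 30 21 ∷ []) ∷
  win 30 25 ∷ [])) (play 46 49 (play 48 48 done (play 34 15 done (win 30 17 ∷ []) ∷ win 30 19 ∷
  [])) (play 34 13 (play 30 15 done (win 44 50 ∷ [])) (force 30 15 (win 44 50) ∷ []) ∷ play 48 48
  (win 30 19) (force 30 17 (win 34 15) ∷ []) ∷ []) ∷ [])) (force 4 27 (play 46 49 (play 48 48 done
  (play 32 17 done (win 30 17 ∷ []) ∷ win 30 19 ∷ [])) (play 32 15 (play 30 15 done (win 44 50 ∷
  [])) (force 30 15 (win 44 50) ∷ []) ∷ play 48 48 (win 30 19) (force 30 17 (win 32 17) ∷ []) ∷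
  [])) ∷ []) ∷ [])) (force 54 45 (play 3 26 (play 1 24 (win 24 31) (force 24 27 (win 26 29) ∷ play
  2 25 (win 26 29) (force 28 27 (win 26 25) ∷ []) ∷ [])) (play 1 24 (play 52 46 (win 24 29) (force
  24 27 (win 26 27) ∷ [])) (force 26 25 (force 30 25 (win 4 27)) ∷ []) ∷ play 5 28 (play 4 27 (win
  30 25) (force 32 23 (win 30 21) ∷ [])) (force 30 21 (force 34 21 (win 6 29)) ∷ []) ∷ [])) ∷
  force 54 45 (play 3 26 (play 1 24 (win 24 31) (force 26 29 (win 24 27) ∷ play 2 25 (win 26 29)
  (force 28 27 (win 26 25) ∷ []) ∷ [])) (play 1 24 (play 52 46 (win 24 29) (force 24 27 (win 26
  27) ∷ [])) (force 4 27 (force 30 25 (win 26 25)) ∷ []) ∷ play 5 28 (play 4 27 (win 30 25) (force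
  32 23 (win 30 21) ∷ [])) (force 6 29 (force 34 21 (win 30 21)) ∷ []) ∷ [])) ∷ play 10 19 (play 8
  17 (play 54 45 (win 24 31) (force 24 27 (win 26 29) ∷ play 52 46 (win 24 29) (force 24 27 (win
  26 27) ∷ []) ∷ [])) (play 52 46 (play 1 11 (play 26 25 done (win 27 26 ∷ win 11 26 ∷ [])) (force
  26 27 (win 11 26) ∷ play 9 18 (win 26 27) (force 26 25 (win 28 25) ∷ []) ∷ [])) (force 44 50
  (force 24 21 (win 26 25)) ∷ []) ∷ play 11 20 (play 54 45 (win 26 29) (play 52 46 (win 26 27)
  (force 26 25 (win 30 23) ∷ []) ∷ force 26 25 (win 30 25) ∷ [])) (play 46 49 (play 48 48 (win 26
  23) (force 26 21 (win 30 19) ∷ [])) (force 44 50 (force 26 19 (win 30 17)) ∷ []) ∷ []) ∷ []))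
  (force 40 18 (play 3 13 (play 1 11 (win 11 30) (force 13 28 (win 11 26) ∷ play 2 12 (win 13 28)
  (force 15 26 (win 13 24) ∷ []) ∷ [])) (play 1 11 (play 38 19 (win 11 28) (force 13 26 (win 11
  26) ∷ [])) (force 4 14 (force 17 24 (win 13 24)) ∷ []) ∷ play 5 15 (play 4 14 (win 17 24) (force
  19 22 (win 17 20) ∷ [])) (force 6 16 (force 21 20 (win 17 20)) ∷ []) ∷ [])) ∷ play 12 21 (play
  13 22 (play 54 45 (win 30 25) (play 52 46 (win 30 23) (force 30 21 (win 34 19) ∷ []) ∷ force 30
  21 (win 34 21) ∷ [])) (play 46 49 (play 48 48 (win 30 19) (force 30 17 (win 34 15) ∷ [])) (force
  44 50 (force 30 15 (win 34 13)) ∷ []) ∷ [])) (force 46 49 (play 11 20 (play 48 48 (win 30 19)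
  (force 30 17 (win 32 17) ∷ [])) (force 44 50 (force 30 15 (win 32 15)) ∷ [])) ∷ []) ∷ []) ∷ [])

after01 : Tree
after01 =
  play 93 18 (play 2 36 (play 142 17 after01234 (after01233 ∷ after01232 ∷ play 40 58 (play 103 42
  (play 105 41 done (play 99 44 done (win 41 63 ∷ play 44 56 done (win 37 57 ∷ win 45 59 ∷ []) ∷
  []) ∷ win 41 65 ∷ play 44 62 done (win 41 63 ∷ []) ∷ [])) (play 101 43 (play 99 44 done (win 41
  61 ∷ play 44 56 done (win 37 57 ∷ win 45 57 ∷ []) ∷ [])) (play 99 44 (win 41 61) (force 44 58
  (win 37 57) ∷ []) ∷ play 44 58 (win 37 57) (force 41 59 (win 99 44) ∷ []) ∷ []) ∷ play 96 48
  (win 41 63) (force 94 49 (win 37 58) ∷ []) ∷ play 96 48 (win 37 60) (force 94 49 (win 37 58) ∷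
  []) ∷ [])) (play 105 41 (play 109 39 (win 41 69) (play 107 40 (win 41 67) (force 41 65 (win 44
  64) ∷ []) ∷ force 44 66 (win 41 65) ∷ [])) (play 101 43 (play 103 42 (win 41 63) (force 41 61
  (win 44 60) ∷ [])) (force 99 44 (force 41 59 (win 44 58)) ∷ []) ∷ play 107 40 (play 39 55 (win
  44 64) (force 44 62 (win 95 48) ∷ [])) (force 99 44 (force 41 59 (win 44 62)) ∷ []) ∷ []) ∷ [])
  ∷ after01230 ∷ [])) (after0122 ∷ [])) (play 63 35 (play 105 10 after01123 (play 101 12 (play 46
  23 (play 99 13 (play 37 28 done (play 66 34 done (win 38 29 ∷ win 67 35 ∷ []) ∷ play 64 36 done
  (win 66 36 ∷ []) ∷ [])) (play 48 25 (play 47 24 done (play 70 30 done (win 72 30 ∷ []) ∷ win 70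
  32 ∷ [])) (play 70 30 (play 74 28 done (win 49 26 ∷ [])) (force 74 28 (win 49 26) ∷ []) ∷ play
  47 24 (win 70 32) (force 70 30 (win 72 30) ∷ []) ∷ []) ∷ play 37 28 (win 64 38) (force 64 36
  (win 66 36) ∷ []) ∷ [])) (play 103 11 (play 48 25 (play 47 24 done (play 70 32 done (win 72 32 ∷
  []) ∷ win 70 34 ∷ [])) (play 70 32 (play 74 30 done (win 49 26 ∷ [])) (force 74 30 (win 49 26) ∷
  []) ∷ play 47 24 (win 70 34) (force 70 32 (win 72 32) ∷ []) ∷ [])) (play 48 25 (play 47 24 (win
  70 34) (force 70 32 (win 72 32) ∷ [])) (force 70 32 (force 74 30 (win 49 26)) ∷ []) ∷ []) ∷ play
  99 13 (play 44 21 (win 64 38) (play 45 22 (win 66 36) (force 66 34 (win 68 34) ∷ []) ∷ force 64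
  36 (win 66 36) ∷ [])) (play 48 25 (play 47 24 (win 70 32) (force 70 30 (win 72 30) ∷ [])) (force
  70 30 (force 74 28 (win 49 26)) ∷ []) ∷ []) ∷ [])) (force 103 11 (play 38 29 (play 37 28 (win 64
  40) (force 66 38 (win 64 38) ∷ [])) (force 64 38 (force 68 36 (win 39 30)) ∷ [])) ∷ []) ∷ force
  66 41 (play 0 38 (play 68 40 (win 37 32) (force 37 30 (win 39 30) ∷ [])) (force 64 42 (force 37
  28 (win 39 28)) ∷ play 1 39 (play 68 40 (win 39 30) (force 39 28 (win 41 28) ∷ [])) (force 41 26
  (force 39 26 (win 64 42)) ∷ []) ∷ [])) ∷ [])) (force 0 38 (play 59 36 (play 44 20 (play 61 35
  (win 37 25) (force 37 23 (win 39 23) ∷ [])) (play 1 39 (play 61 35 (win 39 23) (force 39 21 (win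
  41 21) ∷ [])) (force 41 19 (force 39 19 (win 57 37)) ∷ []) ∷ [])) (force 57 37 (force 37 21
  (force 44 20 (win 39 21))) ∷ [])) ∷ []) ∷ force 50 47 after0102 ∷ [])

strategy : Tree
strategy =
  force 23 20 (force 36 20 after01)

mainTheorem2 : R[ 4 ]= 7
mainTheorem2 = winning strategy tt , upper-bound 3
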